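{- For every $r\in(0,\tfrac12]$ there is a constant $c_r>0$ such that the following holds. For every integer $N\ge 2$ and every ORN design on $N$ nodes that guarantees throughput $r$, the maximum latency $L_{\max}$ of the design satisfies \[ L_{\max}\;\ge\; c_r\, h\left[(\varepsilon N)^{1/h}+N^{1/(h+1)}\right] \;=\; c_r\,L^*(r,N), \] where $h=\lfloor \frac{1}{2r}\rfloor$ and $\varepsilon=h+1-\frac{1}{2r}$.
   Context: Nodes are $[N]=\{1,\dots,N\}$. A connection schedule of size $N$ and period $T\ge1$ is a sequence of permutations $\pi_0,\dots,\pi_{T-1}$ of $[N]$; write $\pi_t=\pi_{t \bmod T}$ for all $t\in\mathbb Z$. Its virtual topology is the directed graph $G$ with vertex set $[N]\times\mathbb Z$ whose edges are the virtual edges $(i,t)\to(i,t+1)$ and the physical edges $(i,t)\to(\pi_t(i),t+1)$, for all $i\in[N]$, $t\in\mathbb Z$. The latency of a finite directed path in $G$ is its number of edges. For $a,b\in[N]$, $t\in\mathbb Z$, $\mathcal P(a,b,t)$ is the set of paths in $G$ from $(a,t)$ to some vertex $(b,t')$, and $\mathcal P$ is the set of all paths. A flow is a function $f:\mathcal P\to[0,\infty)$; the load on an edge $e$ is $F(f,e)=\sum_{P\ni e}f(P)$; $f$ is feasible if $F(f,e)\le 1$ for every physical edge $e$. An oblivious routing scheme $R$ assigns to each $(a,b,t)\in[N]\times[N]\times\mathbb Z$ a flow $R_{a,b,t}$ supported on $\mathcal P(a,b,t)$ with $\sum_P R_{a,b,t}(P)=1$, which is periodic: $R_{a,b,t+T}$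 is obtained from $R_{a,b,t}$ by shifting every path by $T$ in the time coordinate. An ORN design on $N$ nodes is a connection schedule together with an oblivious routing scheme on its virtual topology; its maximum latency is the maximum latency of a path $P$ with $R_{a,b,t}(P)>0$ for some $a,b,t$. A demand function $D$ assigns to each $t\in\mathbb Z$ an $N\times N$ matrix $D(t)$ with nonnegative entries $D(t,a,b)$; it requests throughput equal to the supremum over $t$ of the maximum row sum or column sum of $D(t)$. The induced flow is $f(R,D)=\sum_{a,b,t}D(t,a,b)R_{a,b,t}$. The design guarantees throughput $r$ if $f(R,D)$ is feasible for every demand function $D$ requesting throughput at most $r$. For $r\in(0,\frac12]$, $(h,\varepsilon)$ denotes the unique solution in $\mathbb N\times(0,1]$ of $\frac1{2r}=h+1-\varepsilon$ (equivalently $h=\lfloor\frac1{2r}\rfloor$, $\varepsilon=h+1-\frac1{2r}$), and $L^*(r,N)=h\left(N^{1/(h+1)}+(\varepsilon N)^{1/h}\right)$. -}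

module Defs where

open import Algebra.Bundles using (CommutativeRing)
open import Algebra.Structures using (IsCommutativeRing)
import Algebra.Properties.CommutativeMonoid.Sum as Summation
import Algebra.Properties.Semiring.Exp as Exp
import Algebra.Properties.Semiring.Mult as Mult
open import Data.Fin.Base using (Fin; fromℕ<)
open import Data.Fin.Permutation using (Permutation′; _⟨$⟩ʳ_)
open import Data.Integer.Base as ℤ using (ℤ; +_)
open import Data.Integer.DivMod using (_%ℕ_; n%ℕd<d)
open import Data.List.Base using (List; []; _∷_; foldr; length; map)
open import Data.List.Membership.Propositional using (_∈_)
open import Data.List.Relation.Unary.All using (All)
open import Data.List.Relation.Unary.Unique.Propositional using (Unique)
open import Data.Nat.Base as ℕ using (ℕ; NonZero)
open import Data.Product.Base using (Σ-syntax; ∃; ∃-syntax; _×_; _,_; proj₁)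
open import Data.Sum.Base using (_⊎_)
open import Level using (0ℓ)
open import Relation.Binary.Core using (Rel)
open import Relation.Binary.PropositionalEquality.Core using (_≡_)
open import Relation.Binary.Structures using (IsDecTotalOrder)
open import Relation.Nullary.Negation using (¬_)
open import Relation.Unary using (Pred; U)

module Suprema {A : Set} (_≤_ : Rel A 0ℓ) where

  IsUpperBound : Pred A 0ℓ → A → Set
  IsUpperBound S u = ∀ x → S x → x ≤ u

  IsSupremum : Pred A 0ℓ → A → Set
  IsSupremum S s = IsUpperBound S s × (∀ u → IsUpperBound S u → s ≤ u)

-- The library has no real numbers.  ℝ is used through its axiomatic
-- characterisation: classically, a Dedekind-complete ordered field exists and is
-- unique up to unique isomorphism.  The order is decidable, as it is classically.
record RealField : Set₁ where
  infix  4 _≈_ _≤_ _<_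
  infixl 6 _+_
  infixl 7 _*_
  infix  8 -_
  infix  9 _⁻¹
  field
    Carrier : Set
    _≈_ _≤_ : Rel Carrier 0ℓ
    _+_ _*_ : Carrier → Carrier → Carrier
    -_ _⁻¹  : Carrier → Carrier
    0# 1#   : Carrier

    isCommutativeRing : IsCommutativeRing _≈_ _+_ _*_ -_ 0# 1#
    isDecTotalOrder   : IsDecTotalOrder _≈_ _≤_

    0≉1        : ¬ (0# ≈ 1#)
    -- The value 0# ⁻¹ is unspecified.
    ⁻¹-inverse : ∀ x → ¬ (x ≈ 0#) → x * x ⁻¹ ≈ 1#

    +-mono-≤   : ∀ x y z → x ≤ y → x + z ≤ y + z
    *-nonneg   : ∀ x y → 0# ≤ x → 0# ≤ y → 0# ≤ x * y

  open Suprema _≤_ public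

  field
    complete : (S : Pred Carrier 0ℓ) → ∃ S → ∃ (IsUpperBound S) →
               ∃ (IsSupremum S)

  _<_ : Rel Carrier 0ℓ
  x < y = x ≤ y × ¬ (x ≈ y)

  commutativeRing : CommutativeRing 0ℓ 0ℓ
  commutativeRing = record { isCommutativeRing = isCommutativeRing }

  open CommutativeRing commutativeRing public
    using (_-_; semiring; +-commutativeMonoid)
  open Exp semiring public using (_^_)
  open Mult semiring public using () renaming (_×_ to _·_)
  open Summation +-commutativeMonoid public using (sum)

  fromℕ : ℕ → Carrier
  fromℕ n = n · 1#

  IsFloor : Carrier → ℕ → Set
  IsFloor x n = fromℕ n ≤ x × x < fromℕ (ℕ.suc n)

  -- y = x ^ (1/n), for n ≥ 1 and x ≥ 0.
  IsRoot : ℕ → Carrier → Carrier → Set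
  IsRoot n x y = 0# ≤ y × y ^ n ≈ x

  -- s = Σ_{a ∈ S} f a for nonnegative f, as the supremum of the sums over finite
  -- subsets of S; no such s exists when the sum is infinite.
  IsSumOver : {A : Set} → Pred A 0ℓ → (A → Carrier) → Carrier → Set
  IsSumOver {A} S f = IsSupremum λ v →
    Σ[ xs ∈ List A ] Unique xs × All S xs × v ≈ foldr _+_ 0# (map f xs)

record Schedule (N : ℕ) : Set where
  field
    period : ℕ
    .{{period≥1}} : NonZero period
    perm : Fin period → Permutation′ N

  at : ℤ → Permutation′ N
  at t = perm (fromℕ< (n%ℕd<d t period))

module VirtualTopology {N : ℕ} (σ : Schedule N) where
  open Schedule σ

  Vertex : Set
  Vertex = Fin N × ℤ

  data Kind : Set where
    virtual physical : Kind

  -- Every vertex has exactly one outgoing edge of each kind, so an edge is given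
  -- by its kind and its tail.  If at t fixes i, then the virtual and the physical
  -- edge leaving (i , t) are parallel edges.
  Edge : Set
  Edge = Kind × Vertex

  head : Edge → Vertex
  head (virtual  , i , t) = i , t ℤ.+ + 1
  head (physical , i , t) = at t ⟨$⟩ʳ i , t ℤ.+ + 1

  -- A finite directed path, given by its first vertex and the kinds of its
  -- successive edges.
  record Path : Set where
    constructor path
    field
      start : Vertex
      kinds : List Kind

  open Path public

  edgesFrom : Vertex → List Kind → List Edge
  edgesFrom v []       = []
  edgesFrom v (k ∷ ks) = (k , v) ∷ edgesFrom (head (k , v)) ks

  endFrom : Vertex → List Kind → Vertex
  endFrom v []       = v
  endFrom v (k ∷ ks) = endFrom (head (k , v)) ks

  edges : Path → List Edge
  edges (path v ks) = edgesFrom v ks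

  end : Path → Vertex
  end (path v ks) = endFrom v ks

  latency : Path → ℕ
  latency P = length (edges P)

  𝒫 : Fin N → Fin N → ℤ → Pred Path 0ℓ
  𝒫 a b t P = start P ≡ (a , t) × proj₁ (end P) ≡ b

  -- Translation by one period, an automorphism of the virtual topology.
  shift : Path → Path
  shift (path (i , t) ks) = path (i , t ℤ.+ + period) ks

module Routing (ℝ : RealField) where
  open RealField ℝ

  module Flows {N : ℕ} (σ : Schedule N) where
    open VirtualTopology σ

    record Flow : Set where
      field
        weight : Path → Carrier
        nonneg : ∀ P → 0# ≤ weight P

    open Flow public

    IsLoad : Flow → Edge → Carrier → Set
    IsLoad f e = IsSumOver (λ P → e ∈ edges P) (weight f)

    Feasible : Flow → Set
    Feasible f = ∀ v → ∃[ l ] IsLoad f (physical , v) l × l ≤ 1#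

    record RoutingScheme : Set where
      field
        route     : Fin N → Fin N → ℤ → Flow
        supported : ∀ a b t P → ¬ 𝒫 a b t P → weight (route a b t) P ≈ 0#
        total     : ∀ a b t → IsSumOver U (weight (route a b t)) 1#
        periodic  : ∀ a b t P →
                    weight (route a b (t ℤ.+ + Schedule.period σ)) (shift P)
                      ≈ weight (route a b t) P

  record Demand (N : ℕ) : Set where
    field
      demand : ℤ → Fin N → Fin N → Carrier
      nonneg : ∀ t a b → 0# ≤ demand t a b

    RequestsThroughput : Carrier → Set
    RequestsThroughput = IsSupremum λ v → ∃[ t ]
      ( (∃[ a ] v ≈ sum (λ b → demand t a b))
      ⊎ (∃[ b ] v ≈ sum (λ a → demand t a b)) )

  record ORNDesign (N : ℕ) : Set where
    field
      schedule : Schedule N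

    open VirtualTopology schedule public
    open Flows schedule public

    field
      scheme : RoutingScheme

    open RoutingScheme scheme public

    IsMaxLatency : ℕ → Set
    IsMaxLatency L =
        (∀ a b t P → 0# < weight (route a b t) P → latency P ℕ.≤ L)
      × (∃[ a ] ∃[ b ] ∃[ t ] ∃[ P ]
           0# < weight (route a b t) P × latency P ≡ L)

    IsInducedFlow : Demand N → Flow → Set
    IsInducedFlow D f = ∀ P →
      IsSumOver {Fin N × Fin N × ℤ} U
        (λ (a , b , t) → Demand.demand D t a b * weight (route a b t) P)
        (weight f P)

    GuaranteesThroughput : Carrier → Set
    GuaranteesThroughput r =
      ∀ (D : Demand N) s → Demand.RequestsThroughput D s → s ≤ r →
      ∀ (f : Flow) → IsInducedFlow D f → Feasible f

{-# OPTIONS --safe #-}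
{- Up to constants depending on r, both terms of L* are at most (ε N)^(1/h), so it
   suffices to show ε N ≤ 4 (h+1) q with q = (L+1)^h, L being the maximum latency.

   Within L steps and with at most h physical ones, a walk from or into a given
   vertex has at most q possible other ends.  For a physical edge e let A and B be the
   sets of nodes that reach e, respectively are reached from e, in this way.  The
   demand κ (1_A(a) + 1_B(b)), constant in time, requests throughput at most r for
   κ = r / (N + q), so the routes weighted by it put load at most 1 on e.  Conversely,
   on a path from a to b with at least h+1 physical edges, a ∈ A holds for the first
   h+1 of them and b ∈ B for the last h+1, and all but q of the targets b need such
   paths.  Double counting over a long time window gives
   2 r (h+1) (N − q) ≤ (N + q)(1 + 1/N), and 1/(2r) = h + 1 − ε. -}
module Submission where

open import Defs
open import Algebra.Bundles using (CommutativeRing)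
import Algebra.Properties.Ring as RingProperties
import Algebra.Properties.Semiring.Mult as SemiringMult
import Algebra.Solver.Ring.NaturalCoefficients.Default as NaturalSolver
import Data.Fin.Base as Fin
open import Data.Fin.Base using (Fin)
open import Data.Fin.Permutation using (_⟨$⟩ˡ_; inverseˡ)
import Data.Fin.Properties as Fin
open import Data.Integer.Base as ℤ using (ℤ; +_; -1ℤ)
import Data.Integer.Properties as ℤ
open import Data.List.Base as List
  using (List; []; _∷_; _++_; [_]; map; foldr; filter; length; tabulate; allFin; upTo;
         cartesianProductWith)
open import Data.List.Properties
  using (length-++; length-map; length-tabulate; length-upTo; map-tabulate; map-∘; ∷-injectiveʳ)
open import Data.List.Membership.Propositional using (_∈_)
import Data.List.Membership.DecPropositional as DecMembership
open import Data.List.Membership.Propositional.Properties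
  using (∈-∃++; ∈-++⁻; ∈-++⁺ˡ; ∈-++⁺ʳ; ∈-filter⁺; ∈-filter⁻; ∈-map⁺; ∈-map⁻; ∈-allFin;
         ∈-upTo⁺; ∈-upTo⁻; ∈-cartesianProductWith⁺; ∈-cartesianProductWith⁻)
open import Data.List.Relation.Unary.All as All using ([]; _∷_)
open import Data.List.Relation.Unary.AllPairs using ([]; _∷_)
open import Data.List.Relation.Unary.Any using (here; there)
open import Data.List.Relation.Unary.Unique.Propositional using (Unique)
import Data.List.Relation.Unary.Unique.Propositional.Properties as Unique
open import Data.Nat.Base as ℕ using (ℕ; zero; suc; z≤n; s≤s)
import Data.Nat.Properties as ℕ
open import Data.Product.Base using (∃-syntax; _×_; _,_; proj₁; proj₂)
open import Data.Product.Properties using (≡-dec; ,-injectiveˡ; ,-injectiveʳ)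
open import Data.Sum.Base using (inj₁; inj₂)
open import Function.Base using (_∘_)
open import Level using (0ℓ)
open import Relation.Binary.Bundles using (Poset)
open import Relation.Binary.Definitions using (DecidableEquality)
import Relation.Binary.Reasoning.PartialOrder as PosetReasoning
open import Relation.Binary.PropositionalEquality as ≡ using (_≡_; _≢_; cong; subst)
open import Relation.Binary.Structures using (IsDecTotalOrder)
open import Relation.Nullary using (¬_; Dec; yes; no; contradiction; ¬?)
open import Relation.Unary using (Decidable; Pred)

-- Arithmetic in an ordered field.

module OrderedField (ℝ : RealField) where
  open RealField ℝ
  open CommutativeRing commutativeRing public
    using (refl; sym; trans; +-cong; +-congˡ; +-congʳ; +-identityˡ; +-identityʳ; +-comm;
           +-assoc; *-congˡ; *-congʳ; *-comm; *-assoc; *-identityˡ; *-identityʳ;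
           zeroˡ; zeroʳ; distribˡ; distribʳ; -‿inverseˡ; -‿inverseʳ; commutativeSemiring; ring)
  open RingProperties ring using (-‿distribʳ-*; -‿involutive)
  open SemiringMult semiring using (×-homo-+; ×1-homo-*)
  open NaturalSolver commutativeSemiring public
    using (solve; _:=_; _:+_; _:*_; con)
  open IsDecTotalOrder isDecTotalOrder public
    using (antisym; _≟_)
    renaming (total to ≤-total; refl to ≤-refl; trans to ≤-trans; reflexive to ≤-reflexive)

  poset : Poset 0ℓ 0ℓ 0ℓ
  poset = record { isPartialOrder = IsDecTotalOrder.isPartialOrder isDecTotalOrder }

  module ≤-Reasoning = PosetReasoning poset
  open ≤-Reasoning

  +-mono : ∀ {a b c d} → a ≤ b → c ≤ d → a + c ≤ b + d
  +-mono {a} {b} {c} {d} a≤b c≤d = begin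
    a + c ≤⟨ +-mono-≤ a b c a≤b ⟩
    b + c ≈⟨ +-comm b c ⟩
    c + b ≤⟨ +-mono-≤ c d b c≤d ⟩
    d + b ≈⟨ +-comm d b ⟩
    b + d ∎

  +-nonneg : ∀ {a b} → 0# ≤ a → 0# ≤ b → 0# ≤ a + b
  +-nonneg 0≤a 0≤b = ≤-trans (≤-reflexive (sym (+-identityˡ 0#))) (+-mono 0≤a 0≤b)

  a≤a+b : ∀ {a b} → 0# ≤ b → a ≤ a + b
  a≤a+b {a} 0≤b = ≤-trans (≤-reflexive (sym (+-identityʳ a))) (+-mono ≤-refl 0≤b)

  a≤b+a : ∀ {a b} → 0# ≤ b → a ≤ b + a
  a≤b+a {a} {b} 0≤b = ≤-trans (a≤a+b 0≤b) (≤-reflexive (+-comm a b))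

  +-cancelʳ-≤ : ∀ {a b} c → a + c ≤ b + c → a ≤ b
  +-cancelʳ-≤ {a} {b} c p = begin
    a             ≈⟨ lemma a ⟨
    a + c + (- c) ≤⟨ +-mono-≤ (a + c) (b + c) (- c) p ⟩
    b + c + (- c) ≈⟨ lemma b ⟩
    b             ∎
    where
    lemma : ∀ x → x + c + (- c) ≈ x
    lemma x = trans (+-assoc x c (- c)) (trans (+-congˡ (-‿inverseʳ c)) (+-identityʳ x))

  a-b+b≈a : ∀ a b → a - b + b ≈ a
  a-b+b≈a a b = trans (+-assoc a (- b) b) (trans (+-congˡ (-‿inverseˡ b)) (+-identityʳ a))

  neg-nonneg : ∀ {a} → a ≤ 0# → 0# ≤ - a
  neg-nonneg {a} a≤0 = +-cancelʳ-≤ a (begin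
    0# + a  ≈⟨ +-identityˡ a ⟩
    a       ≤⟨ a≤0 ⟩
    0#      ≈⟨ -‿inverseˡ a ⟨
    - a + a ∎)

  *-monoˡ : ∀ {a b c} → 0# ≤ c → a ≤ b → c * a ≤ c * b
  *-monoˡ {a} {b} {c} 0≤c a≤b = begin
    c * a             ≤⟨ a≤b+a (*-nonneg c (b - a) 0≤c 0≤b-a) ⟩
    c * (b - a) + c * a ≈⟨ distribˡ c (b - a) a ⟨
    c * (b - a + a)   ≈⟨ *-congˡ (a-b+b≈a b a) ⟩
    c * b             ∎
    where
    0≤b-a : 0# ≤ b - a
    0≤b-a = +-cancelʳ-≤ a (begin
      0# + a    ≈⟨ +-identityˡ a ⟩
      a         ≤⟨ a≤b ⟩
      b         ≈⟨ a-b+b≈a b a ⟨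
      b - a + a ∎)

  *-monoʳ : ∀ {a b c} → 0# ≤ c → a ≤ b → a * c ≤ b * c
  *-monoʳ {a} {b} {c} 0≤c a≤b = begin
    a * c ≈⟨ *-comm a c ⟩
    c * a ≤⟨ *-monoˡ 0≤c a≤b ⟩
    c * b ≈⟨ *-comm c b ⟩
    b * c ∎

  *-mono : ∀ {a b c d} → 0# ≤ c → 0# ≤ b → a ≤ b → c ≤ d → a * c ≤ b * d
  *-mono 0≤c 0≤b a≤b c≤d = ≤-trans (*-monoʳ 0≤c a≤b) (*-monoˡ 0≤b c≤d)

  -- If `1# ≤ 0#`, then `- 1#` is nonnegative, and so is its square, which is `1#`.
  0≤1 : 0# ≤ 1#
  0≤1 with ≤-total 0# 1#
  ... | inj₁ p = p
  ... | inj₂ p = begin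
    0#              ≤⟨ *-nonneg (- 1#) (- 1#) (neg-nonneg p) (neg-nonneg p) ⟩
    - 1# * - 1#     ≈⟨ -‿distribʳ-* (- 1#) 1# ⟨
    - (- 1# * 1#)   ≈⟨ -‿cong (*-identityʳ (- 1#)) ⟩
    - (- 1#)        ≈⟨ -‿involutive 1# ⟩
    1#              ∎
    where open CommutativeRing commutativeRing using (-‿cong)

  <⇒≉0 : ∀ {a} → 0# < a → ¬ (a ≈ 0#)
  <⇒≉0 (_ , 0≉a) a≈0 = 0≉a (sym a≈0)

  <-≤-trans : ∀ {a b c} → a < b → b ≤ c → a < c
  <-≤-trans (a≤b , a≉b) b≤c =
    ≤-trans a≤b b≤c , λ a≈c → a≉b (antisym a≤b (≤-trans b≤c (≤-reflexive (sym a≈c))))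

  ⁻¹-nonneg : ∀ {a} → 0# < a → 0# ≤ a ⁻¹
  ⁻¹-nonneg {a} 0<a with ≤-total 0# (a ⁻¹)
  ... | inj₁ p = p
  ... | inj₂ p = contradiction (antisym 0≤1 1≤0) 0≉1
    where
    1≤0 : 1# ≤ 0#
    1≤0 = begin
      1#       ≈⟨ ⁻¹-inverse a (<⇒≉0 0<a) ⟨
      a * a ⁻¹ ≤⟨ *-monoˡ (proj₁ 0<a) p ⟩
      a * 0#   ≈⟨ zeroʳ a ⟩
      0#       ∎

  ⁻¹-inverseˡ : ∀ {a} → 0# < a → a ⁻¹ * a ≈ 1#
  ⁻¹-inverseˡ {a} 0<a = trans (*-comm (a ⁻¹) a) (⁻¹-inverse a (<⇒≉0 0<a))

  a⁻¹*[a*b]≈b : ∀ {a} b → 0# < a → a ⁻¹ * (a * b) ≈ b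
  a⁻¹*[a*b]≈b {a} b 0<a = trans (sym (*-assoc (a ⁻¹) a b))
    (trans (*-congʳ (⁻¹-inverseˡ 0<a)) (*-identityˡ b))

  *-cancelˡ-≤ : ∀ {a b c} → 0# < c → c * a ≤ c * b → a ≤ b
  *-cancelˡ-≤ {a} {b} {c} 0<c p = begin
    a              ≈⟨ a⁻¹*[a*b]≈b a 0<c ⟨
    c ⁻¹ * (c * a) ≤⟨ *-monoˡ (⁻¹-nonneg 0<c) p ⟩
    c ⁻¹ * (c * b) ≈⟨ a⁻¹*[a*b]≈b b 0<c ⟩
    b              ∎

  *-pos : ∀ {a b} → 0# < a → 0# < b → 0# < a * b
  *-pos {a} {b} 0<a 0<b = *-nonneg a b (proj₁ 0<a) (proj₁ 0<b) , λ 0≈ab → proj₂ 0<b (begin-equality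
    0#             ≈⟨ zeroʳ (a ⁻¹) ⟨
    a ⁻¹ * 0#      ≈⟨ *-congˡ 0≈ab ⟩
    a ⁻¹ * (a * b) ≈⟨ a⁻¹*[a*b]≈b b 0<a ⟩
    b              ∎)

  ⁻¹-pos : ∀ {a} → 0# < a → 0# < a ⁻¹
  ⁻¹-pos {a} 0<a = ⁻¹-nonneg 0<a , λ 0≈a⁻¹ → 0≉1 (begin-equality
    0#       ≈⟨ zeroʳ a ⟨
    a * 0#   ≈⟨ *-congˡ 0≈a⁻¹ ⟩
    a * a ⁻¹ ≈⟨ ⁻¹-inverse a (<⇒≉0 0<a) ⟩
    1#       ∎)

  fromℕ-+ : ∀ m n → fromℕ (m ℕ.+ n) ≈ fromℕ m + fromℕ n
  fromℕ-+ = ×-homo-+ 1#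

  fromℕ-* : ∀ m n → fromℕ (m ℕ.* n) ≈ fromℕ m * fromℕ n
  fromℕ-* = ×1-homo-*

  fromℕ-nonneg : ∀ n → 0# ≤ fromℕ n
  fromℕ-nonneg zero    = ≤-refl
  fromℕ-nonneg (suc n) = +-nonneg 0≤1 (fromℕ-nonneg n)

  fromℕ-mono : ∀ {m n} → m ℕ.≤ n → fromℕ m ≤ fromℕ n
  fromℕ-mono {n = n} z≤n = fromℕ-nonneg n
  fromℕ-mono (s≤s m≤n)   = +-mono ≤-refl (fromℕ-mono m≤n)

  fromℕ-pos : ∀ n → 0# < fromℕ (suc n)
  fromℕ-pos n = <-≤-trans (0≤1 , 0≉1) (a≤a+b (fromℕ-nonneg n))

  fromℕ-^ : ∀ m n → fromℕ (m ℕ.^ n) ≈ fromℕ m ^ n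
  fromℕ-^ m zero    = +-identityʳ 1#
  fromℕ-^ m (suc n) = trans (fromℕ-* m (m ℕ.^ n)) (*-congˡ (fromℕ-^ m n))

  ^-nonneg : ∀ {a} n → 0# ≤ a → 0# ≤ a ^ n
  ^-nonneg zero    0≤a = 0≤1
  ^-nonneg {a} (suc n) 0≤a = *-nonneg a (a ^ n) 0≤a (^-nonneg n 0≤a)

  ^-pos : ∀ {a} n → 0# < a → 0# < a ^ n
  ^-pos zero    0<a = 0≤1 , 0≉1
  ^-pos (suc n) 0<a = *-pos 0<a (^-pos n 0<a)

  ^-mono : ∀ {a b} n → 0# ≤ a → a ≤ b → a ^ n ≤ b ^ n
  ^-mono zero    0≤a a≤b = ≤-refl
  ^-mono (suc n) 0≤a a≤b =
    *-mono (^-nonneg n 0≤a) (≤-trans 0≤a a≤b) a≤b (^-mono n 0≤a a≤b)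

  -- When `b ≤ a` and `a` is nonzero, `b * b ^ n ≤ b * a ^ n`, and the positive factor `a ^ n`
  -- cancels. Roots are given only through their powers, so this is how they are compared.
  ^-cancel-≤ : ∀ {a b} n → 0# ≤ a → 0# ≤ b → a ^ suc n ≤ b ^ suc n → a ≤ b
  ^-cancel-≤ {a} {b} n 0≤a 0≤b p with ≤-total a b | a ≟ 0#
  ... | inj₁ a≤b | _       = a≤b
  ... | inj₂ _   | yes a≈0 = ≤-trans (≤-reflexive a≈0) 0≤b
  ... | inj₂ b≤a | no a≉0  = *-cancelˡ-≤ (^-pos n (0≤a , a≉0 ∘ sym)) (begin
    a ^ n * a ≈⟨ *-comm (a ^ n) a ⟩
    a * a ^ n ≤⟨ p ⟩
    b * b ^ n ≤⟨ *-monoˡ 0≤b (^-mono n 0≤b b≤a) ⟩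
    b * a ^ n ≈⟨ *-comm b (a ^ n) ⟩
    a ^ n * b ∎)

  a≤a*b : ∀ {a b} → 0# ≤ a → 1# ≤ b → a ≤ a * b
  a≤a*b {a} 0≤a 1≤b = ≤-trans (≤-reflexive (sym (*-identityʳ a))) (*-monoˡ 0≤a 1≤b)

  a≤b*a : ∀ {a b} → 0# ≤ a → 1# ≤ b → a ≤ b * a
  a≤b*a {a} {b} 0≤a 1≤b = ≤-trans (a≤a*b 0≤a 1≤b) (≤-reflexive (*-comm a b))

  1^ : ∀ n → 1# ^ n ≈ 1#
  1^ zero    = refl
  1^ (suc n) = trans (*-identityˡ _) (1^ n)

  1≤^ : ∀ {a} n → 1# ≤ a → 1# ≤ a ^ n
  1≤^ zero    1≤a = ≤-refl
  1≤^ (suc n) 1≤a = ≤-trans 1≤a (a≤a*b (≤-trans 0≤1 1≤a) (1≤^ n 1≤a))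

  a≤a^ : ∀ {a} n → 1# ≤ a → a ≤ a ^ suc n
  a≤a^ n 1≤a = a≤a*b (≤-trans 0≤1 1≤a) (1≤^ n 1≤a)

  *-^ : ∀ a b n → (a * b) ^ n ≈ a ^ n * b ^ n
  *-^ a b zero    = sym (*-identityˡ 1#)
  *-^ a b (suc n) = trans (*-congˡ (*-^ a b n))
    (solve 4 (λ a b c d → (a :* b) :* (c :* d) := (a :* c) :* (b :* d)) refl a b (a ^ n) (b ^ n))

  -- Indicators and finite sums over lists.

  ind : {P : Set} → Dec P → Carrier
  ind (yes _) = 1#
  ind (no _)  = 0#

  ind-nonneg : {P : Set} (d : Dec P) → 0# ≤ ind d
  ind-nonneg (yes _) = 0≤1
  ind-nonneg (no _)  = ≤-refl

  ind≤1 : {P : Set} (d : Dec P) → ind d ≤ 1#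
  ind≤1 (yes _) = ≤-refl
  ind≤1 (no _)  = 0≤1

  ind-yes : {P : Set} (d : Dec P) → P → ind d ≈ 1#
  ind-yes (yes _) _ = refl
  ind-yes (no ¬p) p = contradiction p ¬p

  module _ {A : Set} where

    ∑ : List A → (A → Carrier) → Carrier
    ∑ xs f = foldr _+_ 0# (map f xs)

    ∑-cong : ∀ xs {f g} → (∀ x → f x ≈ g x) → ∑ xs f ≈ ∑ xs g
    ∑-cong []       f≈g = refl
    ∑-cong (x ∷ xs) f≈g = +-cong (f≈g x) (∑-cong xs f≈g)

    ∑-mono∈ : ∀ xs {f g} → (∀ {x} → x ∈ xs → f x ≤ g x) → ∑ xs f ≤ ∑ xs g
    ∑-mono∈ []       f≤g = ≤-refl
    ∑-mono∈ (x ∷ xs) f≤g = +-mono (f≤g (here ≡.refl)) (∑-mono∈ xs (f≤g ∘ there))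

    ∑-mono : ∀ xs {f g} → (∀ x → f x ≤ g x) → ∑ xs f ≤ ∑ xs g
    ∑-mono xs f≤g = ∑-mono∈ xs λ {x} _ → f≤g x

    ∑-nonneg : ∀ xs {f} → (∀ x → 0# ≤ f x) → 0# ≤ ∑ xs f
    ∑-nonneg []       0≤f = ≤-refl
    ∑-nonneg (x ∷ xs) 0≤f = +-nonneg (0≤f x) (∑-nonneg xs 0≤f)

    ∑-+ : ∀ xs f g → ∑ xs (λ x → f x + g x) ≈ ∑ xs f + ∑ xs g
    ∑-+ []       f g = sym (+-identityˡ 0#)
    ∑-+ (x ∷ xs) f g = trans (+-congˡ (∑-+ xs f g))
      (solve 4 (λ a b c d → (a :+ b) :+ (c :+ d) := (a :+ c) :+ (b :+ d)) refl
        (f x) (g x) (∑ xs f) (∑ xs g))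

    ∑-*ˡ : ∀ xs c f → ∑ xs (λ x → c * f x) ≈ c * ∑ xs f
    ∑-*ˡ []       c f = sym (zeroʳ c)
    ∑-*ˡ (x ∷ xs) c f = trans (+-congˡ (∑-*ˡ xs c f)) (sym (distribˡ c (f x) (∑ xs f)))

    ∑-const : ∀ xs c → ∑ xs (λ _ → c) ≈ fromℕ (length xs) * c
    ∑-const []       c = sym (zeroˡ c)
    ∑-const (x ∷ xs) c = trans (+-congˡ (∑-const xs c))
      (solve 2 (λ a b → a :+ b :* a := (con 1 :+ b) :* a) refl c (fromℕ (length xs)))

    ∑-++ : ∀ xs ys f → ∑ (xs ++ ys) f ≈ ∑ xs f + ∑ ys f
    ∑-++ []       ys f = sym (+-identityˡ (∑ ys f))
    ∑-++ (x ∷ xs) ys f = trans (+-congˡ (∑-++ xs ys f)) (sym (+-assoc (f x) (∑ xs f) (∑ ys f)))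

    ∑-filter : {P : Pred A 0ℓ} (P? : Decidable P) → ∀ xs f →
               ∑ (filter P? xs) f ≈ ∑ xs (λ x → ind (P? x) * f x)
    ∑-filter P? []       f = refl
    ∑-filter P? (x ∷ xs) f with P? x
    ... | yes _ = +-cong (sym (*-identityˡ (f x))) (∑-filter P? xs f)
    ... | no _  = trans (∑-filter P? xs f)
      (trans (sym (+-identityˡ _)) (+-congʳ (sym (zeroˡ (f x)))))

    -- Each nonzero term of `xs` is located in `ys` and removed there; uniqueness of `xs` keeps the
    -- remaining terms available after the removal. Zero terms may lie outside `ys`, so a sum over
    -- an arbitrary finite set of paths is bounded by one over the paths that can carry weight.
    ∑-⊆ : ∀ {xs ys f} → Unique xs → (∀ x → 0# ≤ f x) →
          (∀ {x} → x ∈ xs → ¬ (f x ≈ 0#) → x ∈ ys) → ∑ xs f ≤ ∑ ys f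
    ∑-⊆ {[]}     {ys} _           0≤f sub = ∑-nonneg ys 0≤f
    ∑-⊆ {x ∷ xs} {ys} {f} (x∉ ∷ u) 0≤f sub with f x ≟ 0#
    ... | yes fx≈0 = begin
      f x + ∑ xs f ≈⟨ +-congʳ fx≈0 ⟩
      0# + ∑ xs f  ≈⟨ +-identityˡ _ ⟩
      ∑ xs f       ≤⟨ ∑-⊆ u 0≤f (sub ∘ there) ⟩
      ∑ ys f       ∎
    ... | no fx≉0 with as , bs , ≡.refl ← ∈-∃++ (sub (here ≡.refl) fx≉0) = begin
      f x + ∑ xs f                ≤⟨ +-mono ≤-refl (∑-⊆ u 0≤f sub′) ⟩
      f x + ∑ (as ++ bs) f        ≈⟨ +-congˡ (∑-++ as bs f) ⟩
      f x + (∑ as f + ∑ bs f)     ≈⟨ solve 3 (λ a b c → a :+ (b :+ c) := b :+ (a :+ c)) refl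
                                       (f x) (∑ as f) (∑ bs f) ⟩
      ∑ as f + (f x + ∑ bs f)     ≈⟨ ∑-++ as (x ∷ bs) f ⟨
      ∑ (as ++ [ x ] ++ bs) f     ∎
      where
      sub′ : ∀ {z} → z ∈ xs → ¬ (f z ≈ 0#) → z ∈ as ++ bs
      sub′ z∈ fz≉0 with ∈-++⁻ as (sub (there z∈) fz≉0)
      ... | inj₁ p         = ∈-++⁺ˡ p
      ... | inj₂ (here e)  = contradiction (≡.sym e) (All.lookup x∉ z∈)
      ... | inj₂ (there p) = ∈-++⁺ʳ as p

  ∑-swap : {A B : Set} (xs : List A) (ys : List B) (f : A → B → Carrier) →
           ∑ xs (λ x → ∑ ys (f x)) ≈ ∑ ys (λ y → ∑ xs (λ x → f x y))
  ∑-swap []       ys f = sym (trans (∑-const ys 0#) (zeroʳ _))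
  ∑-swap (x ∷ xs) ys f =
    trans (+-congˡ (∑-swap xs ys f)) (sym (∑-+ ys (f x) (λ y → ∑ xs (λ x → f x y))))

  ∑-map : {A B : Set} (g : A → B) (xs : List A) (f : B → Carrier) →
          ∑ (map g xs) f ≡ ∑ xs (f ∘ g)
  ∑-map g xs f = cong (foldr _+_ 0#) (≡.sym (map-∘ xs))

  ∑-cartesianProductWith : {A B C : Set} (g : A → B → C) (xs : List A) (ys : List B)
    (f : C → Carrier) → ∑ (cartesianProductWith g xs ys) f ≈ ∑ xs (λ x → ∑ ys (λ y → f (g x y)))
  ∑-cartesianProductWith g []       ys f = refl
  ∑-cartesianProductWith g (x ∷ xs) ys f =
    trans (∑-++ (map (g x) ys) (cartesianProductWith g xs ys) f)
      (+-cong (CommutativeRing.reflexive commutativeRing (∑-map (g x) ys f))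
        (∑-cartesianProductWith g xs ys f))

  sum≡∑ : ∀ {n} (f : Fin n → Carrier) → sum f ≡ ∑ (allFin n) f
  sum≡∑ {n} f = ≡.trans (lemma n f) (cong (foldr _+_ 0#) (≡.sym (map-tabulate (λ i → i) f)))
    where
    lemma : ∀ n (f : Fin n → Carrier) → sum f ≡ foldr _+_ 0# (tabulate f)
    lemma zero    f = ≡.refl
    lemma (suc n) f = cong (λ v → f Fin.zero + v) (lemma n (f ∘ Fin.suc))

length-cartesianProductWith : {A B C : Set} (f : A → B → C) (xs : List A) (ys : List B) →
  length (cartesianProductWith f xs ys) ≡ length xs ℕ.* length ys
length-cartesianProductWith f []       ys = ≡.refl
length-cartesianProductWith f (x ∷ xs) ys = ≡.trans (length-++ (map (f x) ys))
  (≡.cong₂ ℕ._+_ (length-map (f x) ys) (length-cartesianProductWith f xs ys))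

-- Balls of bounded hop count in the virtual topology.

module Reachability {N : ℕ} (σ : Schedule N) where
  open VirtualTopology σ
  open Schedule σ

  _≟ᴷ_ : DecidableEquality Kind
  virtual  ≟ᴷ virtual  = yes ≡.refl
  virtual  ≟ᴷ physical = no λ ()
  physical ≟ᴷ virtual  = no λ ()
  physical ≟ᴷ physical = yes ≡.refl

  _≟ⱽ_ : DecidableEquality Vertex
  _≟ⱽ_ = ≡-dec Fin._≟_ ℤ._≟_

  _≟ᴱ_ : DecidableEquality Edge
  _≟ᴱ_ = ≡-dec _≟ᴷ_ _≟ⱽ_

  -- Nodes at which a walk of exactly n steps with at most j physical ones can end.
  ball : (Kind → Vertex → Vertex) → ℕ → ℕ → Vertex → List (Fin N)
  ball step zero    j       v = [ proj₁ v ]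
  ball step (suc n) zero    v = ball step n zero (step virtual v)
  ball step (suc n) (suc j) v =
    ball step n (suc j) (step virtual v) ++ ball step n j (step physical v)

  -- The recursion of `ball` yields the bound `(n+1)^(j+1) + (n+1)^j = (n+2) (n+1)^j`, which is at
  -- most `(n+2)^(j+1)`.
  length-ball : ∀ step n j v → length (ball step n j v) ℕ.≤ suc n ℕ.^ j
  length-ball step zero    j       v = ℕ.m^n>0 1 j
  length-ball step (suc n) zero    v = length-ball step n zero (step virtual v)
  length-ball step (suc n) (suc j) v = begin
    length (ball step n (suc j) (step virtual v) ++ ball step n j (step physical v))
      ≡⟨ length-++ (ball step n (suc j) (step virtual v)) ⟩
    length (ball step n (suc j) (step virtual v)) ℕ.+ length (ball step n j (step physical v))
      ≤⟨ ℕ.+-mono-≤ (length-ball step n (suc j) (step virtual v))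
                    (length-ball step n j (step physical v)) ⟩
    suc n ℕ.* suc n ℕ.^ j ℕ.+ suc n ℕ.^ j   ≡⟨ ℕ.+-comm (suc n ℕ.^ suc j) (suc n ℕ.^ j) ⟩
    suc (suc n) ℕ.* suc n ℕ.^ j             ≤⟨ ℕ.*-monoʳ-≤ (suc (suc n)) (ℕ.^-monoˡ-≤ j (ℕ.n≤1+n (suc n))) ⟩
    suc (suc n) ℕ.* suc (suc n) ℕ.^ j       ∎
    where open ℕ.≤-Reasoning

  ∈-ball-virtual : ∀ step {a} n j v → a ∈ ball step n j (step virtual v) → a ∈ ball step (suc n) j v
  ∈-ball-virtual step n zero    v a∈ = a∈
  ∈-ball-virtual step n (suc j) v a∈ = ∈-++⁺ˡ a∈

  ∈-ball-physical : ∀ step {a} n j v → a ∈ ball step n j (step physical v) →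
                    a ∈ ball step (suc n) (suc j) v
  ∈-ball-physical step n j v a∈ = ∈-++⁺ʳ (ball step n (suc j) (step virtual v)) a∈

  -- The physical edge arriving at time `t` comes from the permutation at time `t - 1`, so a
  -- backward step inverts that one.
  forward backward : Kind → Vertex → Vertex
  forward k v = head (k , v)
  backward virtual  (i , t) = i , t ℤ.+ -1ℤ
  backward physical (i , t) = at (t ℤ.+ -1ℤ) ⟨$⟩ˡ i , t ℤ.+ -1ℤ

  t+1-1≡t : ∀ t → t ℤ.+ + 1 ℤ.+ -1ℤ ≡ t
  t+1-1≡t t = ≡.trans (ℤ.+-assoc t (+ 1) -1ℤ) (ℤ.+-identityʳ t)

  backward-forward : ∀ k v → backward k (forward k v) ≡ v
  backward-forward virtual  (i , t) = cong (i ,_) (t+1-1≡t t)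
  backward-forward physical (i , t) rewrite t+1-1≡t t = cong (_, t) (inverseˡ (at t))

  -- The walk that only waits stays at its node. Waiting also pads shorter walks to exactly `n`
  -- steps.
  centre∈ball : ∀ step → (∀ v → proj₁ (step virtual v) ≡ proj₁ v) →
                ∀ n j v → proj₁ v ∈ ball step n j v
  centre∈ball step eq zero    j v = here ≡.refl
  centre∈ball step eq (suc n) j v = ∈-ball-virtual step n j v
    (subst (_∈ ball step n j (step virtual v)) (eq v) (centre∈ball step eq n j (step virtual v)))

  -- A physical edge is determined by its tail, so this represents the physical edges of a path in
  -- the order of traversal.
  physTails : Vertex → List Kind → List Vertex
  physTails v []              = []
  physTails v (virtual ∷ ks)  = physTails (forward virtual v) ks
  physTails v (physical ∷ ks) = v ∷ physTails (forward physical v) ks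

  hops : List Kind → ℕ
  hops []              = 0
  hops (virtual ∷ ks)  = hops ks
  hops (physical ∷ ks) = suc (hops ks)

  end∈ball : ∀ {n j} v ks → length ks ℕ.≤ n → hops ks ℕ.≤ j →
             proj₁ (endFrom v ks) ∈ ball forward n j v
  end∈ball {n} {j} v []    _ _ = centre∈ball forward (λ _ → ≡.refl) n j v
  end∈ball {suc n} {j} v (virtual ∷ ks) (s≤s l) c =
    ∈-ball-virtual forward n j v (end∈ball (forward virtual v) ks l c)
  end∈ball {suc n} {suc j} v (physical ∷ ks) (s≤s l) (s≤s c) =
    ∈-ball-physical forward n j v (end∈ball (forward physical v) ks l c)

  -- Monotone closure of membership in backward balls, so that the bounds can grow
  -- along a path.
  ReachedFrom : Fin N → ℕ → ℕ → Vertex → Set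
  ReachedFrom a n j v = ∀ {n′ j′} → n ℕ.≤ n′ → j ℕ.≤ j′ → a ∈ ball backward n′ j′ v

  reached-start : ∀ a t → ReachedFrom a 0 0 (a , t)
  reached-start a t {n′} {j′} _ _ = centre∈ball backward (λ _ → ≡.refl) n′ j′ (a , t)

  reached-virtual : ∀ {a n j v} → ReachedFrom a n j v → ReachedFrom a (suc n) j (forward virtual v)
  reached-virtual {a} {v = v} r {suc n′} {j′} (s≤s l) c =
    ∈-ball-virtual backward n′ j′ (forward virtual v)
      (subst (λ w → a ∈ ball backward n′ j′ w) (≡.sym (backward-forward virtual v)) (r l c))

  reached-physical : ∀ {a n j v} → ReachedFrom a n j v →
                     ReachedFrom a (suc n) (suc j) (forward physical v)
  reached-physical {a} {v = v} r {suc n′} {suc j′} (s≤s l) (s≤s c) =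
    ∈-ball-physical backward n′ j′ (forward physical v)
      (subst (λ w → a ∈ ball backward n′ j′ w) (≡.sym (backward-forward physical v)) (r l c))

  -- Enumeration of the paths of bounded latency that start in a time window.

  words : ℕ → List (List Kind)
  words zero    = [ [] ]
  words (suc n) = [] ∷ map (virtual ∷_) (words n) ++ map (physical ∷_) (words n)

  ∈-words : ∀ {n} ks → length ks ℕ.≤ n → ks ∈ words n
  ∈-words {zero}  []              _       = here ≡.refl
  ∈-words {suc n} []              _       = here ≡.refl
  ∈-words {suc n} (virtual ∷ ks)  (s≤s l) = there (∈-++⁺ˡ (∈-map⁺ _ (∈-words ks l)))
  ∈-words {suc n} (physical ∷ ks) (s≤s l) =
    there (∈-++⁺ʳ (map (virtual ∷_) (words n)) (∈-map⁺ _ (∈-words ks l)))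

  length-∈words : ∀ {n ks} → ks ∈ words n → length ks ℕ.≤ n
  length-∈words {zero}  (here ≡.refl) = z≤n
  length-∈words {suc n} (here ≡.refl) = z≤n
  length-∈words {suc n} (there p) with ∈-++⁻ (map (virtual ∷_) (words n)) p
  ... | inj₁ q with _ , q′ , ≡.refl ← ∈-map⁻ _ q = s≤s (length-∈words q′)
  ... | inj₂ q with _ , q′ , ≡.refl ← ∈-map⁻ _ q = s≤s (length-∈words q′)

  words-unique : ∀ n → Unique (words n)
  words-unique zero    = [] ∷ []
  words-unique (suc n) =
    All.tabulate []≢ ∷
    Unique.++⁺ (Unique.map⁺ ∷-injectiveʳ (words-unique n)) (Unique.map⁺ ∷-injectiveʳ (words-unique n)) disjoint
    where
    []≢ : ∀ {ks} → ks ∈ map (virtual ∷_) (words n) ++ map (physical ∷_) (words n) → [] ≢ ks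
    []≢ p ≡.refl with ∈-++⁻ (map (virtual ∷_) (words n)) p
    ... | inj₁ q with () ← proj₂ (proj₂ (∈-map⁻ _ q))
    ... | inj₂ q with () ← proj₂ (proj₂ (∈-map⁻ _ q))
    disjoint : ∀ {ks} → ¬ (ks ∈ map (virtual ∷_) (words n) × ks ∈ map (physical ∷_) (words n))
    disjoint (p , q) with _ , _ , ≡.refl ← ∈-map⁻ _ p with () ← proj₂ (proj₂ (∈-map⁻ _ q))

  -- The times run from `0` up to, but not including, `m`. Double counting uses such a window for
  -- the starts of paths and a longer one for the tails of their physical edges.
  vertices : ℕ → List Vertex
  vertices m = cartesianProductWith (λ i s → i , + s) (allFin N) (upTo m)

  length-vertices : ∀ m → length (vertices m) ≡ N ℕ.* m
  length-vertices m = ≡.trans (length-cartesianProductWith _ (allFin N) (upTo m))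
    (≡.cong₂ ℕ._*_ (length-tabulate {n = N} (λ i → i)) (length-upTo m))

  vertices-unique : ∀ m → Unique (vertices m)
  vertices-unique m = Unique.cartesianProductWith⁺ _
    (λ eq → ,-injectiveˡ eq , ℤ.+-injective (,-injectiveʳ eq))
    (Unique.allFin⁺ N) (Unique.upTo⁺ m)

  ∈-vertices : ∀ {m} i {s} → s ℕ.< m → (i , + s) ∈ vertices m
  ∈-vertices i s<m = ∈-cartesianProductWith⁺ _ (∈-allFin i) (∈-upTo⁺ s<m)

  paths : ℕ → ℕ → List Path
  paths m l = cartesianProductWith path (vertices m) (words l)

  paths-unique : ∀ m l → Unique (paths m l)
  paths-unique m l = Unique.cartesianProductWith⁺ path (λ { ≡.refl → ≡.refl , ≡.refl })
    (vertices-unique m) (words-unique l)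

  -- Position in time of the physical edges of a path.

  physTails⊆edges : ∀ v ks {w} → w ∈ physTails v ks → (physical , w) ∈ edgesFrom v ks
  physTails⊆edges v (virtual ∷ ks)  p           = there (physTails⊆edges _ ks p)
  physTails⊆edges v (physical ∷ ks) (here ≡.refl) = here ≡.refl
  physTails⊆edges v (physical ∷ ks) (there p)   = there (physTails⊆edges _ ks p)

  physTails-time : ∀ v ks {w} → w ∈ physTails v ks → proj₂ v ℤ.≤ proj₂ w
  physTails-time (i , t) (virtual ∷ ks) p =
    ℤ.≤-trans (ℤ.i≤i+j t (+ 1)) (physTails-time _ ks p)
  physTails-time v (physical ∷ ks) (here ≡.refl) = ℤ.≤-refl
  physTails-time (i , t) (physical ∷ ks) (there p) =
    ℤ.≤-trans (ℤ.i≤i+j t (+ 1)) (physTails-time _ ks p)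

  -- Every edge advances time by one, so a later tail differs from all earlier ones in its time.
  physTails-unique : ∀ v ks → Unique (physTails v ks)
  physTails-unique v []              = []
  physTails-unique v (virtual ∷ ks)  = physTails-unique _ ks
  physTails-unique (i , t) (physical ∷ ks) = All.tabulate later ∷ physTails-unique _ ks
    where
    later : ∀ {w} → w ∈ physTails (forward physical (i , t)) ks → (i , t) ≢ w
    later p ≡.refl = ℤ.<-irrefl ≡.refl (ℤ.suc[i]≤j⇒i<j
      (subst (ℤ._≤ t) (ℤ.+-comm t (+ 1)) (physTails-time _ ks p)))

  -- The last edge leaves one time step before the path ends, so the end time `s + length ks` may
  -- itself equal `m`.
  physTails⊆vertices : ∀ {m} i s ks → s ℕ.+ length ks ℕ.≤ m →
                       ∀ {w} → w ∈ physTails (i , + s) ks → w ∈ vertices m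
  physTails⊆vertices i s (k ∷ ks) l p = go k p
    where
    l′ : s ℕ.+ 1 ℕ.+ length ks ℕ.≤ _
    l′ = ℕ.≤-trans (ℕ.≤-reflexive (ℕ.+-assoc s 1 (length ks))) l
    go : ∀ k {w} → w ∈ physTails (i , + s) (k ∷ ks) → w ∈ vertices _
    go virtual  p           = physTails⊆vertices _ (s ℕ.+ 1) ks l′ p
    go physical (here ≡.refl) = ∈-vertices i (ℕ.≤-trans (ℕ.m<m+n s (s≤s z≤n)) l)
    go physical (there p)   = physTails⊆vertices _ (s ℕ.+ 1) ks l′ p

-- Counting nodes, edges and paths.

module Counting (ℝ : RealField) where
  open RealField ℝ
  open OrderedField ℝ
  open ≤-Reasoning hiding (start)

  module _ {N : ℕ} where
    open DecMembership (Fin._≟_ {N}) using (_∈?_)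

    -- The nodes of `allFin N` that occur in `ys` form a duplicate-free list, whereas `ys` may
    -- repeat nodes; hence only an inequality.
    ∑-ind≤length : ∀ ys → ∑ (allFin N) (λ b → ind (b ∈? ys)) ≤ fromℕ (length ys)
    ∑-ind≤length ys = begin
      ∑ (allFin N) (λ b → ind (b ∈? ys))        ≈⟨ ∑-cong (allFin N) (λ b → *-identityʳ _) ⟨
      ∑ (allFin N) (λ b → ind (b ∈? ys) * 1#)   ≈⟨ ∑-filter (_∈? ys) (allFin N) (λ _ → 1#) ⟨
      ∑ (filter (_∈? ys) (allFin N)) (λ _ → 1#)
        ≤⟨ ∑-⊆ (Unique.filter⁺ (_∈? ys) (Unique.allFin⁺ N)) (λ _ → 0≤1)
             (λ p _ → proj₂ (∈-filter⁻ (_∈? ys) {xs = allFin N} p)) ⟩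
      ∑ ys (λ _ → 1#)                           ≈⟨ ∑-const ys 1# ⟩
      fromℕ (length ys) * 1#                    ≈⟨ *-identityʳ _ ⟩
      fromℕ (length ys)                         ∎

    N≤∑-ind+length : ∀ ys → fromℕ N ≤ ∑ (allFin N) (λ b → ind (¬? (b ∈? ys))) + fromℕ (length ys)
    N≤∑-ind+length ys = begin
      fromℕ N                              ≈⟨ *-identityʳ (fromℕ N) ⟨
      fromℕ N * 1#                         ≡⟨ cong (λ m → fromℕ m * 1#) (length-tabulate {n = N} (λ i → i)) ⟨
      fromℕ (length (allFin N)) * 1#       ≈⟨ ∑-const (allFin N) 1# ⟨
      ∑ (allFin N) (λ _ → 1#)              ≤⟨ ∑-mono (allFin N) (λ b → lemma (b ∈? ys)) ⟩
      ∑ (allFin N) (λ b → ind (¬? (b ∈? ys)) + ind (b ∈? ys)) ≈⟨ ∑-+ (allFin N) _ _ ⟩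
      ∑ (allFin N) (λ b → ind (¬? (b ∈? ys))) + ∑ (allFin N) (λ b → ind (b ∈? ys))
        ≤⟨ +-mono ≤-refl (∑-ind≤length ys) ⟩
      ∑ (allFin N) (λ b → ind (¬? (b ∈? ys))) + fromℕ (length ys) ∎
      where
      lemma : {P : Set} (d : Dec P) → 1# ≤ ind (¬? d) + ind d
      lemma (yes _) = a≤b+a ≤-refl
      lemma (no _)  = a≤a+b ≤-refl

  -- Physical edges close to the source or the target of a path.

  module HopCount {N : ℕ} (σ : Schedule N) (L h : ℕ) where
    open VirtualTopology σ
    open Reachability σ
    open DecMembership (Fin._≟_ {N}) using (_∈?_)

    -- For the physical edge `e` with tail `v`, these are the indicators of the sets `A` and `B`.
    -- Sources are measured to the tail and targets from the head, so `e` itself is not among the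
    -- `h` hops; this is why `h + 1` edges of a path count on each side.
    nearSource nearTarget : Vertex → Fin N → Carrier
    nearSource v a = ind (a ∈? ball backward L h v)
    nearTarget v b = ind (b ∈? ball forward L h (forward physical v))

    near : Vertex → Fin N → Fin N → Carrier
    near v a b = nearSource v a + nearTarget v b

    nearSource-nonneg : ∀ v a → 0# ≤ nearSource v a
    nearSource-nonneg v a = ind-nonneg (a ∈? ball backward L h v)

    nearTarget-nonneg : ∀ v b → 0# ≤ nearTarget v b
    nearTarget-nonneg v b = ind-nonneg (b ∈? ball forward L h (forward physical v))

    near-nonneg : ∀ v a b → 0# ≤ near v a b
    near-nonneg v a b = +-nonneg (nearSource-nonneg v a) (nearTarget-nonneg v b)

    ∑-nearSource : ∀ v → ∑ (allFin N) (nearSource v) ≤ fromℕ (suc L ℕ.^ h)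
    ∑-nearSource v = ≤-trans (∑-ind≤length (ball backward L h v))
      (fromℕ-mono (length-ball backward L h v))

    ∑-nearTarget : ∀ v → ∑ (allFin N) (nearTarget v) ≤ fromℕ (suc L ℕ.^ h)
    ∑-nearTarget v = ≤-trans (∑-ind≤length (ball forward L h (forward physical v)))
      (fromℕ-mono (length-ball forward L h (forward physical v)))

    -- With `j` hops made between `a` and `v`, each of the next `k` physical tails is reached after
    -- at most `j + k - 1` hops, that is, at most `h`, so its indicator is `1`.
    nearSource-count : ∀ {a n j} v ks k → ReachedFrom a n j v → n ℕ.+ length ks ℕ.≤ L →
      k ℕ.≤ hops ks → j ℕ.+ k ℕ.≤ suc h → fromℕ k ≤ ∑ (physTails v ks) (λ w → nearSource w a)
    nearSource-count {a} v ks zero _ _ _ _ = ∑-nonneg (physTails v ks) (λ w → nearSource-nonneg w a)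
    nearSource-count {n = n} v (virtual ∷ ks) (suc k) R l c d =
      nearSource-count _ ks (suc k) (reached-virtual R)
        (ℕ.≤-trans (ℕ.≤-reflexive (≡.sym (ℕ.+-suc n (length ks)))) l) c d
    nearSource-count {a} {n} {j} v (physical ∷ ks) (suc k) R l (s≤s c) d = +-mono
      (≤-reflexive (sym (ind-yes (a ∈? ball backward L h v)
        (R (ℕ.m+n≤o⇒m≤o n l) (ℕ.m+n≤o⇒m≤o j (ℕ.≤-pred 1+j+k≤1+h))))))
      (nearSource-count _ ks k (reached-physical R)
        (ℕ.≤-trans (ℕ.≤-reflexive (≡.sym (ℕ.+-suc n (length ks)))) l) c 1+j+k≤1+h)
      where
      1+j+k≤1+h : suc (j ℕ.+ k) ℕ.≤ suc h
      1+j+k≤1+h = ℕ.≤-trans (ℕ.≤-reflexive (≡.sym (ℕ.+-suc j k))) d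

    -- A physical edge with at most `h` hops after it has the end of the path in the forward ball
    -- around its head. These edges come last, so the recursion skips edges until few enough hops
    -- remain.
    nearTarget-count : ∀ v ks k → length ks ℕ.≤ L → k ℕ.≤ hops ks → k ℕ.≤ suc h →
      fromℕ k ≤ ∑ (physTails v ks) (λ w → nearTarget w (proj₁ (endFrom v ks)))
    nearTarget-count v ks zero _ _ _ =
      ∑-nonneg (physTails v ks) (λ w → nearTarget-nonneg w (proj₁ (endFrom v ks)))
    nearTarget-count v (virtual ∷ ks) (suc k) l c d =
      nearTarget-count _ ks (suc k) (ℕ.<⇒≤ l) c d
    nearTarget-count v (physical ∷ ks) (suc k) l (s≤s c) (s≤s d) with hops ks ℕ.≤? h
    ... | yes few = +-mono
      (≤-reflexive (sym (ind-yes (_ ∈? ball forward L h (forward physical v))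
        (end∈ball (forward physical v) ks (ℕ.<⇒≤ l) few))))
      (nearTarget-count _ ks k (ℕ.<⇒≤ l) c (ℕ.m≤n⇒m≤1+n d))
    -- More than `h` hops remain after this edge, hence at least `suc k`, and all the edges to be
    -- counted are found among them.
    ... | no many = ≤-trans
      (nearTarget-count _ ks (suc k) (ℕ.<⇒≤ l) (ℕ.≤-trans (s≤s d) (ℕ.≰⇒> many)) (s≤s d))
      (a≤b+a (nearTarget-nonneg v (proj₁ (endFrom (forward physical v) ks))))

    -- This depends only on the two ends of `P`, not on its own hops, so that for a fixed start it
    -- can be summed over targets.
    far : Path → Carrier
    far P = ind (¬? (proj₁ (end P) ∈? ball forward L h (start P)))

    -- An end outside the ball forces at least `h + 1` hops, so the first and the last `h + 1` of
    -- them count. An edge belonging to both groups counts twice, since `near` adds the two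
    -- indicators.
    near-count : ∀ v ks → length ks ℕ.≤ L →
      fromℕ (2 ℕ.* suc h) * far (path v ks)
        ≤ ∑ (physTails v ks) (λ w → near w (proj₁ v) (proj₁ (endFrom v ks)))
    near-count v ks l with proj₁ (endFrom v ks) ∈? ball forward L h v
    ... | yes _  = ≤-trans (≤-reflexive (zeroʳ _))
      (∑-nonneg (physTails v ks) (λ w → near-nonneg w (proj₁ v) (proj₁ (endFrom v ks))))
    ... | no ∉ball = begin
      fromℕ (2 ℕ.* suc h) * 1#      ≈⟨ *-identityʳ _ ⟩
      fromℕ (2 ℕ.* suc h)           ≡⟨ cong (λ m → fromℕ (suc h ℕ.+ m)) (ℕ.+-identityʳ (suc h)) ⟩
      fromℕ (suc h ℕ.+ suc h)       ≈⟨ fromℕ-+ (suc h) (suc h) ⟩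
      fromℕ (suc h) + fromℕ (suc h) ≤⟨ +-mono
        (nearSource-count v ks (suc h) (reached-start (proj₁ v) (proj₂ v)) l many ℕ.≤-refl)
        (nearTarget-count v ks (suc h) l many ℕ.≤-refl) ⟩
      ∑ (physTails v ks) (λ w → nearSource w (proj₁ v))
        + ∑ (physTails v ks) (λ w → nearTarget w (proj₁ (endFrom v ks))) ≈⟨ ∑-+ (physTails v ks) _ _ ⟨
      ∑ (physTails v ks) (λ w → near w (proj₁ v) (proj₁ (endFrom v ks))) ∎
      where
      many : suc h ℕ.≤ hops ks
      many = ℕ.≰⇒> λ few → ∉ball (end∈ball v ks l few)

  open Routing ℝ

  -- Routes as finite sums over paths of latency at most `L`.

  module Latency {N : ℕ} (design : ORNDesign (suc N)) {L : ℕ}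
    (isMax : ORNDesign.IsMaxLatency design L) where
    open ORNDesign design
    open Reachability schedule

    -- The total weight `1#` is the least upper bound of finite partial sums. A path of nonzero
    -- weight starts at `(a , t)` and has at most `L` edges, so each partial sum is bounded by the
    -- sum over `words L`.
    total-words : ∀ a b t → 1# ≤ ∑ (words L) (λ ks → weight (route a b t) (path (a , t) ks))
    total-words a b t = proj₂ (total a b t) _ bound
      where
      w : Path → Carrier
      w = weight (route a b t)
      supported-on-words : ∀ P → ¬ (w P ≈ 0#) → P ∈ map (path (a , t)) (words L)
      supported-on-words P w≉0 with start P ≟ⱽ (a , t)
      ... | no start≢ = contradiction (supported a b t P (start≢ ∘ proj₁)) w≉0
      ... | yes ≡.refl = ∈-map⁺ (path (a , t)) (∈-words (kinds P)
        (subst (ℕ._≤ L) (length-edges (start P) (kinds P))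
          (proj₁ isMax a b t P (nonneg (route a b t) P , w≉0 ∘ sym))))
        where
        length-edges : ∀ v ks → length (edgesFrom v ks) ≡ length ks
        length-edges v []       = ≡.refl
        length-edges v (k ∷ ks) = cong suc (length-edges (head (k , v)) ks)
      bound : IsUpperBound _ (∑ (words L) (λ ks → w (path (a , t) ks)))
      bound x (Ps , unique , _ , x≈) = begin
        x                                ≈⟨ x≈ ⟩
        ∑ Ps w  
          ≤⟨ ∑-⊆ unique (nonneg (route a b t)) (λ {P} _ → supported-on-words P) ⟩
        ∑ (map (path (a , t)) (words L)) w ≡⟨ ∑-map (path (a , t)) (words L) w ⟩
        ∑ (words L) (λ ks → w (path (a , t) ks)) ∎

    open DecMembership _≟ᴱ_ using () renaming (_∈?_ to _∈ᴱ?_)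
    open DecMembership (Fin._≟_ {suc N}) using (_∈?_)

    -- By the support condition, only the route whose source, target and time are read off from `P`
    -- can give `P` weight.
    own : Path → Carrier
    own P = weight (route (proj₁ (start P)) (proj₁ (end P)) (proj₂ (start P))) P

    own-nonneg : ∀ P → 0# ≤ own P
    own-nonneg P = nonneg (route (proj₁ (start P)) (proj₁ (end P)) (proj₂ (start P))) P

    -- The demand attached to an edge, and the double count.

    module Load {r : Carrier} (0<r : 0# < r) (guarantee : GuaranteesThroughput r) (h : ℕ) where
      open HopCount schedule L h

      n q κ : Carrier
      n = fromℕ (suc N)
      q = fromℕ (suc L ℕ.^ h)
      κ = r * (n + q) ⁻¹

      0<n+q : 0# < n + q
      0<n+q = <-≤-trans (fromℕ-pos N) (a≤a+b (fromℕ-nonneg (suc L ℕ.^ h)))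

      0≤κ : 0# ≤ κ
      0≤κ = *-nonneg r _ (proj₁ 0<r) (⁻¹-nonneg 0<n+q)

      κ[n+q]≈r : κ * (n + q) ≈ r
      κ[n+q]≈r = trans (*-assoc r _ _) (trans (*-congˡ (⁻¹-inverseˡ 0<n+q)) (*-identityʳ r))

      demandAt : Vertex → Demand (suc N)
      demandAt v = record
        { demand = λ t a b → κ * near v a b
        ; nonneg = λ t a b → *-nonneg κ _ 0≤κ (near-nonneg v a b)
        }

      -- Along a row or column of the demand one indicator is a constant `c` and the other sums to
      -- at most `q`, which explains the normalisation of `κ` by `n + q`.
      marginal≤r : ∀ c f → c ≤ 1# → ∑ (allFin (suc N)) f ≤ q →
        ∑ (allFin (suc N)) (λ x → κ * (c + f x)) ≤ r
      marginal≤r c f c≤1 Σf≤q = begin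
        ∑ xs (λ x → κ * (c + f x))      ≈⟨ ∑-*ˡ xs κ _ ⟩
        κ * ∑ xs (λ x → c + f x)        ≈⟨ *-congˡ (∑-+ xs _ f) ⟩
        κ * (∑ xs (λ _ → c) + ∑ xs f)   ≤⟨ *-monoˡ 0≤κ (+-mono (∑-mono xs (λ _ → c≤1)) Σf≤q) ⟩
        κ * (∑ xs (λ _ → 1#) + q)       ≈⟨ *-congˡ (+-congʳ (∑-const xs 1#)) ⟩
        κ * (fromℕ (length xs) * 1# + q) ≈⟨ *-congˡ (+-congʳ (*-identityʳ _)) ⟩
        κ * (fromℕ (length xs) + q)     ≡⟨ cong (λ m → κ * (fromℕ m + q)) (length-tabulate {n = suc N} (λ i → i)) ⟩
        κ * (n + q)                     ≈⟨ κ[n+q]≈r ⟩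
        r                               ∎
        where
        xs : List (Fin (suc N))
        xs = allFin (suc N)

      throughput : ∀ v → ∃[ s ] Demand.RequestsThroughput (demandAt v) s × s ≤ r
      throughput v = proj₁ sup , proj₂ sup , proj₂ (proj₂ sup) r r-bound
        where
        r-bound : IsUpperBound _ r
        r-bound x (t , inj₁ (a , x≈)) = begin
          x                                           ≈⟨ x≈ ⟩
          sum (λ b → κ * near v a b)                  ≡⟨ sum≡∑ (λ b → κ * near v a b) ⟩
          ∑ (allFin (suc N)) (λ b → κ * near v a b)
            ≤⟨ marginal≤r _ _ (ind≤1 (a ∈? ball backward L h v)) (∑-nearTarget v) ⟩
          r                                           ∎
        r-bound x (t , inj₂ (b , x≈)) = begin
          x                                           ≈⟨ x≈ ⟩
          sum (λ a → κ * near v a b)                  ≡⟨ sum≡∑ (λ a → κ * near v a b) ⟩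
          ∑ (allFin (suc N)) (λ a → κ * near v a b)   ≈⟨ ∑-cong (allFin (suc N)) (λ a → *-congˡ (+-comm _ _)) ⟩
          ∑ (allFin (suc N)) (λ a → κ * (nearTarget v b + nearSource v a))
            ≤⟨ marginal≤r _ _ (ind≤1 (b ∈? ball forward L h (forward physical v)))
               (∑-nearSource v) ⟩
          r                                           ∎
        sup : ∃[ s ] Demand.RequestsThroughput (demandAt v) s
        -- The sum of the row of `Fin.zero` at time `0` shows that the set of marginals is
        -- inhabited.
        sup = complete _ (_ , + 0 , inj₁ (Fin.zero , refl)) (r , r-bound)

      load : Vertex → Path → Carrier
      load v P = κ * near v (proj₁ (start P)) (proj₁ (end P)) * own P

      load-nonneg : ∀ v P → 0# ≤ load v P
      load-nonneg v P = *-nonneg _ _ (*-nonneg κ _ 0≤κ (near-nonneg v _ _)) (own-nonneg P)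

      flowAt : Vertex → Flow
      flowAt v = record { weight = load v ; nonneg = load-nonneg v }

      -- At a path `P` all terms of the induced flow vanish except the one for the source, target
      -- and starting time of `P`; that term is an upper bound and is itself a partial sum.
      flowAt-induced : ∀ v → IsInducedFlow (demandAt v) (flowAt v)
      flowAt-induced v P = upper , least
        where
        a₀ = proj₁ (start P)
        b₀ = proj₁ (end P)
        t₀ = proj₂ (start P)
        term : Fin (suc N) × Fin (suc N) × ℤ → Carrier
        term (a , b , t) = κ * near v a b * weight (route a b t) P
        single : ∑ [ (a₀ , b₀ , t₀) ] term ≈ load v P
        single = +-identityʳ _
        only : ∀ z → ¬ (term z ≈ 0#) → z ∈ [ (a₀ , b₀ , t₀) ]
        only (a , b , t) ≉0 with start P ≟ⱽ (a , t) | b₀ Fin.≟ b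
        ... | yes ≡.refl | yes ≡.refl = here ≡.refl
        ... | no ¬p | _ = contradiction (trans (*-congˡ (supported a b t P (¬p ∘ proj₁))) (zeroʳ _)) ≉0
        ... | _ | no ¬p = contradiction (trans (*-congˡ (supported a b t P (¬p ∘ proj₂))) (zeroʳ _)) ≉0
        upper : IsUpperBound _ (load v P)
        upper x (zs , unique , _ , x≈) = begin
          x                            ≈⟨ x≈ ⟩
          ∑ zs term                    ≤⟨ ∑-⊆ unique
            (λ (a , b , t) → *-nonneg _ _ (*-nonneg κ _ 0≤κ (near-nonneg v a b)) (nonneg (route a b t) P))
            (λ {z} _ → only z) ⟩
          ∑ [ (a₀ , b₀ , t₀) ] term    ≈⟨ single ⟩
          load v P                     ∎
        least : ∀ u → IsUpperBound _ u → load v P ≤ u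
        least u bound = bound (load v P)
          ([ (a₀ , b₀ , t₀) ] , [] ∷ [] , _ ∷ [] , sym single)

      through : Vertex → Path → Carrier
      through v P = ind ((physical , v) ∈ᴱ? edges P)

      -- The guarantee is applied to the demand attached to this very edge. The load is a supremum,
      -- so the finitely many paths of `Ps` through the edge contribute no more than it.
      edge-load≤1 : ∀ v {Ps} → Unique Ps → ∑ Ps (λ P → through v P * load v P) ≤ 1#
      edge-load≤1 v {Ps} unique
        with s , requests , s≤r ← throughput v
        with l , isLoad , l≤1 ← guarantee (demandAt v) s requests s≤r (flowAt v) (flowAt-induced v) v
        = begin
        ∑ Ps (λ P → through v P * load v P) ≈⟨ ∑-filter on? Ps (load v) ⟨
        ∑ (filter on? Ps) (load v)          ≤⟨ proj₁ isLoad _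
          (filter on? Ps , Unique.filter⁺ on? unique , All.tabulate (λ p → proj₂ (∈-filter⁻ on? {xs = Ps} p)) , refl) ⟩
        l                                   ≤⟨ l≤1 ⟩
        1#                                  ∎
        where
        on? : ∀ P → Dec ((physical , v) ∈ edges P)
        on? P = (physical , v) ∈ᴱ? edges P

      -- The count along one path becomes a sum over a window independent of the path, so that sums
      -- over paths and edges can be exchanged.
      path-near : ∀ {m} i s ks → s ℕ.+ length ks ℕ.≤ m → length ks ℕ.≤ L →
        let P = path (i , + s) ks in
        fromℕ (2 ℕ.* suc h) * far P
          ≤ ∑ (vertices m) (λ v → through v P * near v i (proj₁ (end P)))
      path-near {m} i s ks fits short = begin
        fromℕ (2 ℕ.* suc h) * far P       ≤⟨ near-count (i , + s) ks short ⟩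
        ∑ (physTails (i , + s) ks) f      ≤⟨ ∑-⊆ (physTails-unique (i , + s) ks) (λ v → near-nonneg v i b)
          (λ p _ → ∈-filter⁺ on? (physTails⊆vertices i s ks fits p) (physTails⊆edges (i , + s) ks p)) ⟩
        ∑ (filter on? (vertices m)) f     ≈⟨ ∑-filter on? (vertices m) f ⟩
        ∑ (vertices m) (λ v → through v P * f v) ∎
        where
        P = path (i , + s) ks
        b = proj₁ (end P)
        f : Vertex → Carrier
        f v = near v i b
        on? : ∀ v → Dec ((physical , v) ∈ edges P)
        on? v = (physical , v) ∈ᴱ? edges P

      -- Summed over all targets, this is the weight of the far paths in the routes that leave `v`.
      farFlow : Vertex → Carrier
      farFlow v = ∑ (words L) (λ ks → own (path v ks) * far (path v ks))

      -- All but at most `q` targets lie outside the ball, and the route to each of them has weight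
      -- at least `1` on words. After exchanging the sums, each word retains only the target at
      -- which it ends.
      n≤farFlow+q : ∀ v → n ≤ farFlow v + q
      n≤farFlow+q v@(a , t) = begin
        n ≤⟨ N≤∑-ind+length reached ⟩
        ∑ nodes good + fromℕ (length reached) ≤⟨ +-mono good≤ (fromℕ-mono (length-ball forward L h v)) ⟩
        farFlow v + q ∎
        where
        nodes = allFin (suc N)
        reached = ball forward L h v
        good : Fin (suc N) → Carrier
        good b = ind (¬? (b ∈? reached))
        R : Fin (suc N) → List Kind → Carrier
        R b ks = weight (route a b t) (path v ks)
        good≤ : ∑ nodes good ≤ farFlow v
        good≤ = begin
          ∑ nodes good
            ≤⟨ ∑-mono nodes (λ b → a≤a*b (ind-nonneg (¬? (b ∈? reached))) (total-words a b t)) ⟩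
          ∑ nodes (λ b → good b * ∑ (words L) (R b))
            ≈⟨ ∑-cong nodes (λ b → ∑-*ˡ (words L) (good b) (R b)) ⟨
          ∑ nodes (λ b → ∑ (words L) (λ ks → good b * R b ks))
            ≈⟨ ∑-swap nodes (words L) _ ⟩
          ∑ (words L) (λ ks → ∑ nodes (λ b → good b * R b ks))
            ≤⟨ ∑-mono (words L) only-end ⟩
          farFlow v ∎
          where
          only-end : ∀ ks → ∑ nodes (λ b → good b * R b ks) ≤ own (path v ks) * far (path v ks)
          only-end ks = begin
            ∑ nodes (λ b → good b * R b ks)      ≤⟨ ∑-⊆ (Unique.allFin⁺ (suc N))
              (λ b → *-nonneg _ _ (ind-nonneg (¬? (b ∈? reached))) (nonneg (route a b t) (path v ks)))
              (λ {b} _ → at-end b) ⟩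
            ∑ [ e ] (λ b → good b * R b ks)      ≈⟨ +-identityʳ _ ⟩
            good e * R e ks                      ≈⟨ *-comm _ _ ⟩
            own (path v ks) * far (path v ks)    ∎
            where
            e = proj₁ (endFrom v ks)
            at-end : ∀ b → ¬ (good b * R b ks ≈ 0#) → b ∈ [ e ]
            at-end b ≉0 with e Fin.≟ b
            ... | yes ≡.refl = here ≡.refl
            ... | no e≢b = contradiction
              (trans (*-congˡ (supported a b t (path v ks) (e≢b ∘ proj₂))) (zeroʳ _)) ≉0

      -- Paths starting before time `m` have all their physical tails before time `m + L`. Each far
      -- path carries nearness at least `2 (h + 1)` on these edges, while each edge has load at most
      -- `1` under its own demand.
      total-load : ∀ m → κ * (fromℕ (2 ℕ.* suc h) * ∑ (vertices m) farFlow)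
                           ≤ fromℕ (suc N ℕ.* (m ℕ.+ L))
      total-load m = begin
        κ * (H * ∑ (vertices m) farFlow)
          ≈⟨ *-congˡ (*-congˡ (∑-cartesianProductWith path (vertices m) (words L) _)) ⟨
        κ * (H * ∑ Ps (λ P → own P * far P))
          ≈⟨ *-congˡ (∑-*ˡ Ps H _) ⟨
        κ * ∑ Ps (λ P → H * (own P * far P))
          ≤⟨ *-monoˡ 0≤κ (∑-mono∈ Ps bound) ⟩
        κ * ∑ Ps (λ P → own P * ∑ Es (λ v → through v P * near′ v P))
          ≈⟨ ∑-*ˡ Ps κ _ ⟨
        ∑ Ps (λ P → κ * (own P * ∑ Es (λ v → through v P * near′ v P)))
          ≈⟨ ∑-cong Ps (λ P → trans (*-congˡ (sym (∑-*ˡ Es (own P) _))) (sym (∑-*ˡ Es κ _))) ⟩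
        ∑ Ps (λ P → ∑ Es (λ v → κ * (own P * (through v P * near′ v P))))
          ≈⟨ ∑-cong Ps (λ P → ∑-cong Es (λ v →
               solve 4 (λ k o t w → k :* (o :* (t :* w)) := t :* (k :* w :* o)) refl
                 κ (own P) (through v P) (near′ v P))) ⟩
        ∑ Ps (λ P → ∑ Es (λ v → through v P * load v P))
          -- Summation passes from paths to edges.
          ≈⟨ ∑-swap Ps Es _ ⟩
        ∑ Es (λ v → ∑ Ps (λ P → through v P * load v P))
          ≤⟨ ∑-mono Es (λ v → edge-load≤1 v (paths-unique m L)) ⟩
        ∑ Es (λ _ → 1#)       ≈⟨ ∑-const Es 1# ⟩
        fromℕ (length Es) * 1# ≈⟨ *-identityʳ _ ⟩
        fromℕ (length Es)     ≡⟨ cong fromℕ (length-vertices (m ℕ.+ L)) ⟩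
        fromℕ (suc N ℕ.* (m ℕ.+ L)) ∎
        where
        H = fromℕ (2 ℕ.* suc h)
        Ps = paths m L
        Es = vertices (m ℕ.+ L)
        near′ : Vertex → Path → Carrier
        near′ v P = near v (proj₁ (start P)) (proj₁ (end P))
        bound : ∀ {P} → P ∈ Ps →
                H * (own P * far P) ≤ own P * ∑ Es (λ v → through v P * near′ v P)
        bound {P} P∈
          with _ , ks , v∈ , ks∈ , ≡.refl ← ∈-cartesianProductWith⁻ path (vertices m) (words L) P∈
          with i , s , _ , s∈ , ≡.refl ← ∈-cartesianProductWith⁻ _ (allFin (suc N)) (List.upTo m) v∈ = begin
          H * (own P * far P)
            ≈⟨ solve 3 (λ x o g → x :* (o :* g) := o :* (x :* g)) refl H (own P) (far P) ⟩
          own P * (H * far P)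
            ≤⟨ *-monoˡ (own-nonneg P) (path-near i s ks
                 (ℕ.+-mono-≤ (ℕ.<⇒≤ (∈-upTo⁻ s∈)) short) short) ⟩
          own P * ∑ Es (λ v → through v P * near′ v P) ∎
          where
          short : length ks ℕ.≤ L
          short = length-∈words ks∈

-- From the double count to a bound on `ε N`.

module LowerBound (ℝ : RealField) where
  open RealField ℝ
  open OrderedField ℝ
  open Counting ℝ
  open Routing ℝ
  open ≤-Reasoning

  -- With latency `0` only the empty path could carry the route between two distinct nodes, but it
  -- does not end at the target.
  1≤L : ∀ {N L} (design : ORNDesign (suc (suc N))) → ORNDesign.IsMaxLatency design L → 1 ℕ.≤ L
  1≤L {L = suc _} design isMax = s≤s z≤n
  1≤L {L = zero}  design isMax = contradiction (antisym 0≤1 1≤0) 0≉1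
    where
    open ORNDesign design
    b : Fin.Fin _
    b = Fin.suc Fin.zero
    1≤0 : 1# ≤ 0#
    1≤0 = begin
      1# ≤⟨ Latency.total-words design isMax Fin.zero b (+ 0) ⟩
      weight (route Fin.zero b (+ 0)) (path (Fin.zero , + 0) []) + 0#
         ≈⟨ +-identityʳ _ ⟩
      weight (route Fin.zero b (+ 0)) (path (Fin.zero , + 0) [])
         ≈⟨ supported Fin.zero b (+ 0) _ (λ { (_ , ()) }) ⟩
      0# ∎

  module _ {r : Carrier} (0<r : 0# < r) (h : ℕ) {ε ρ : Carrier}
    (ρ*2r≈1 : ρ * (fromℕ 2 * r) ≈ 1#) (0≤ρ : 0# ≤ ρ) (0≤ε : 0# ≤ ε)
    (ε+ρ≈H : ε + ρ ≈ fromℕ (suc h)) where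

    private
      H : Carrier
      H = fromℕ (suc h)

      0≤H : 0# ≤ H
      0≤H = fromℕ-nonneg (suc h)

    -- The sum `X` of `farFlow` over the window is bounded from below by the number of far targets
    -- and from above by the total load. Eliminating `X` and substituting `H = ε + ρ` cancels the
    -- leading term `ρ * n`; the rest uses `ρ ≤ H`.
    εN≤4[h+1]ball : ∀ {N L} (design : ORNDesign (suc N)) → ORNDesign.IsMaxLatency design L →
      ORNDesign.GuaranteesThroughput design r →
      ε * fromℕ (suc N) ≤ fromℕ 4 * H * fromℕ (suc L) ^ h
    εN≤4[h+1]ball {N} {L} design isMax guarantee = begin
      ε * n                    ≤⟨ +-cancelʳ-≤ (ρ * n) step₃ ⟩
      (ρ + ρ + ρ + H) * q      ≤⟨ *-monoʳ 0≤q (+-mono (+-mono (+-mono ρ≤H ρ≤H) ρ≤H) ≤-refl) ⟩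
      (H + H + H + H) * q      ≈⟨ solve 2 (λ H q → (H :+ H :+ H :+ H) :* q :=
                                    (con 1 :+ (con 1 :+ (con 1 :+ (con 1 :+ con 0)))) :* H :* q) refl H q ⟩
      fromℕ 4 * H * q          ≈⟨ *-congˡ (fromℕ-^ (suc L) h) ⟩
      fromℕ 4 * H * fromℕ (suc L) ^ h ∎
      where
      open Latency design isMax
      open Load 0<r guarantee h
      open ORNDesign design
      open Reachability schedule
      -- With this many starting times, the L extra time steps into which paths may
      -- run cost a factor of at most 1 + 1/(N+1).
      window = suc N ℕ.* suc L
      starts = vertices window
      l X : Carrier
      l = fromℕ (suc L)
      X = ∑ starts farFlow

      0≤n : 0# ≤ n
      0≤n = fromℕ-nonneg (suc N)

      0≤q : 0# ≤ q
      0≤q = fromℕ-nonneg (suc L ℕ.^ h)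

      1≤n : 1# ≤ n
      1≤n = a≤a+b (fromℕ-nonneg N)

      1≤q : 1# ≤ q
      1≤q = ≤-trans (a≤a+b ≤-refl) (fromℕ-mono (ℕ.m^n>0 (suc L) h))

      ρ≤H : ρ ≤ H
      ρ≤H = ≤-trans (a≤b+a 0≤ε) (≤-reflexive ε+ρ≈H)

      |starts|≈ : fromℕ (length starts) ≈ n * (n * l)
      |starts|≈ = begin-equality
        fromℕ (length starts)    ≡⟨ cong fromℕ (length-vertices window) ⟩
        fromℕ (suc N ℕ.* window) ≈⟨ fromℕ-* (suc N) window ⟩
        n * fromℕ window         ≈⟨ *-congˡ (fromℕ-* (suc N) (suc L)) ⟩
        n * (n * l)              ∎

      lower : n * (n * l) * n ≤ X + n * (n * l) * q
      lower = begin
        n * (n * l) * n                ≈⟨ *-congʳ |starts|≈ ⟨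
        fromℕ (length starts) * n      ≈⟨ ∑-const starts n ⟨
        ∑ starts (λ _ → n)             ≤⟨ ∑-mono starts n≤farFlow+q ⟩
        ∑ starts (λ v → farFlow v + q) ≈⟨ ∑-+ starts farFlow _ ⟩
        X + ∑ starts (λ _ → q)         ≈⟨ +-congˡ (∑-const starts q) ⟩
        X + fromℕ (length starts) * q  ≈⟨ +-congˡ (*-congʳ |starts|≈) ⟩
        X + n * (n * l) * q            ∎

      edges≤ : fromℕ (suc N ℕ.* (window ℕ.+ L)) ≤ n * ((n + 1#) * l)
      edges≤ = begin
        fromℕ (suc N ℕ.* (window ℕ.+ L))  ≈⟨ fromℕ-* (suc N) (window ℕ.+ L) ⟩
        n * fromℕ (window ℕ.+ L)          ≤⟨ *-monoˡ 0≤n (fromℕ-mono (ℕ.+-monoʳ-≤ window (ℕ.n≤1+n L))) ⟩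
        n * fromℕ (window ℕ.+ suc L)      ≈⟨ *-congˡ (fromℕ-+ window (suc L)) ⟩
        n * (fromℕ window + l)            ≈⟨ *-congˡ (+-congʳ (fromℕ-* (suc N) (suc L))) ⟩
        n * (n * l + l)                   ≈⟨ solve 2 (λ n l → n :* (n :* l :+ l) := n :* ((n :+ con 1) :* l)) refl n l ⟩
        n * ((n + 1#) * l)                ∎

      -- The factor `1` is written as `ρ * 2r` with `r = κ * (n + q)`, which produces the left side
      -- of `total-load`.
      upper : H * X ≤ ρ * (n * ((n + 1#) * l) * (n + q))
      upper = begin
        H * X                                     ≈⟨ *-identityˡ _ ⟨
        1# * (H * X)                              ≈⟨ *-congʳ ρ*2r≈1 ⟨
        ρ * (fromℕ 2 * r) * (H * X)               ≈⟨ *-congʳ (*-congˡ (*-congˡ κ[n+q]≈r)) ⟨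
        ρ * (fromℕ 2 * (κ * (n + q))) * (H * X)
          ≈⟨ solve 6 (λ ρ t k s H X → ρ :* (t :* (k :* s)) :* (H :* X) := ρ :* (k :* (t :* H :* X) :* s))
               refl ρ (fromℕ 2) κ (n + q) H X ⟩
        ρ * (κ * (fromℕ 2 * H * X) * (n + q))     ≈⟨ *-congˡ (*-congʳ (*-congˡ (*-congʳ (fromℕ-* 2 (suc h))))) ⟨
        ρ * (κ * (fromℕ (2 ℕ.* suc h) * X) * (n + q))
          ≤⟨ *-monoˡ 0≤ρ (*-monoʳ (+-nonneg 0≤n 0≤q) (≤-trans (total-load window) edges≤)) ⟩
        ρ * (n * ((n + 1#) * l) * (n + q))        ∎

      step₁ : H * n * n ≤ ρ * ((n + 1#) * (n + q)) + H * n * q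
      step₁ = *-cancelˡ-≤ (*-pos (fromℕ-pos N) (fromℕ-pos L)) (begin
        n * l * (H * n * n)
          ≈⟨ solve 3 (λ n l H → n :* l :* (H :* n :* n) := H :* (n :* (n :* l) :* n)) refl n l H ⟩
        H * (n * (n * l) * n)                ≤⟨ *-monoˡ 0≤H lower ⟩
        H * (X + n * (n * l) * q)            ≈⟨ distribˡ H X _ ⟩
        H * X + H * (n * (n * l) * q)        ≤⟨ +-mono upper ≤-refl ⟩
        ρ * (n * ((n + 1#) * l) * (n + q)) + H * (n * (n * l) * q)
          ≈⟨ solve 5 (λ n l q ρ H →
               ρ :* (n :* ((n :+ con 1) :* l) :* (n :+ q)) :+ H :* (n :* (n :* l) :* q) :=
               n :* l :* (ρ :* ((n :+ con 1) :* (n :+ q)) :+ H :* n :* q)) refl n l q ρ H ⟩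
        n * l * (ρ * ((n + 1#) * (n + q)) + H * n * q) ∎)

      -- Since `n` and `q` are at least `1`, the lower-order terms `n` and `q` of the product are
      -- each at most `n * q`.
      step₂ : (n + 1#) * (n + q) ≤ n * (n + q + q + q)
      step₂ = begin
        (n + 1#) * (n + q)
          ≈⟨ solve 2 (λ n q → (n :+ con 1) :* (n :+ q) := n :* n :+ n :* q :+ n :* con 1 :+ con 1 :* q) refl n q ⟩
        n * n + n * q + n * 1# + 1# * q
          ≤⟨ +-mono (+-mono ≤-refl (*-monoˡ 0≤n 1≤q)) (*-monoʳ 0≤q 1≤n) ⟩
        n * n + n * q + n * q + n * q
          ≈⟨ solve 2 (λ n q → n :* n :+ n :* q :+ n :* q :+ n :* q := n :* (n :+ q :+ q :+ q)) refl n q ⟩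
        n * (n + q + q + q) ∎

      step₃ : ε * n + ρ * n ≤ (ρ + ρ + ρ + H) * q + ρ * n
      step₃ = *-cancelˡ-≤ (fromℕ-pos N) (begin
        n * (ε * n + ρ * n)
          ≈⟨ *-congˡ (sym (distribʳ n ε ρ)) ⟩
        n * ((ε + ρ) * n)                         ≈⟨ *-congˡ (*-congʳ ε+ρ≈H) ⟩
        n * (H * n)
          ≈⟨ solve 2 (λ n H → n :* (H :* n) := H :* n :* n) refl n H ⟩
        H * n * n                                 ≤⟨ step₁ ⟩
        ρ * ((n + 1#) * (n + q)) + H * n * q      ≤⟨ +-mono (*-monoˡ 0≤ρ step₂) ≤-refl ⟩
        ρ * (n * (n + q + q + q)) + H * n * q
          ≈⟨ solve 4 (λ n q ρ H →
               ρ :* (n :* (n :+ q :+ q :+ q)) :+ H :* n :* q :=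
               n :* ((ρ :+ ρ :+ ρ :+ H) :* q :+ ρ :* n)) refl n q ρ H ⟩
        n * ((ρ + ρ + ρ + H) * q + ρ * n)         ∎)

-- From the bound on `ε N` to the latency.

theorem3p2 : (ℝ : RealField) →
    let open RealField ℝ
        open Routing ℝ
    in
    (r : Carrier) → 0# < r → r ≤ (fromℕ 2) ⁻¹ →
    (h : ℕ) → IsFloor ((fromℕ 2 * r) ⁻¹) h →
    let ε = (fromℕ h + 1#) - (fromℕ 2 * r) ⁻¹
    in
    ∃[ c ] 0# < c ×
    ((N : ℕ) → 2 ℕ.≤ N →
    (design : ORNDesign N) → ORNDesign.GuaranteesThroughput design r →
    (Lmax : ℕ) → ORNDesign.IsMaxLatency design Lmax →
    (x y : Carrier) →
    IsRoot h (ε * fromℕ N) x → IsRoot (suc h) (fromℕ N) y →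
    c * (fromℕ h * (x + y)) ≤ fromℕ Lmax)
-- The case `h = 0` is impossible: `r ≤ 1/2` gives `1/(2r) ≥ 1`, while the floor places it below
-- `1`.
theorem3p2 ℝ r 0<r r≤½ zero (_ , ρ≤1 , ρ≉1) =
  contradiction (antisym ρ≤1 (≤-trans (≤-reflexive (+-identityʳ 1#)) 1≤ρ)) ρ≉1
  where
  open RealField ℝ
  open OrderedField ℝ
  open ≤-Reasoning
  0<2r : 0# < fromℕ 2 * r
  0<2r = *-pos (fromℕ-pos 1) 0<r
  1≤ρ : 1# ≤ (fromℕ 2 * r) ⁻¹
  1≤ρ = begin
    1#                              ≈⟨ ⁻¹-inverseˡ 0<2r ⟨
    (fromℕ 2 * r) ⁻¹ * (fromℕ 2 * r) ≤⟨ *-monoˡ (⁻¹-nonneg 0<2r) (*-monoˡ (fromℕ-nonneg 2) r≤½) ⟩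
    (fromℕ 2 * r) ⁻¹ * (fromℕ 2 * fromℕ 2 ⁻¹) ≈⟨ *-congˡ (⁻¹-inverse (fromℕ 2) (<⇒≉0 (fromℕ-pos 1))) ⟩
    (fromℕ 2 * r) ⁻¹ * 1#           ≈⟨ *-identityʳ _ ⟩
    (fromℕ 2 * r) ⁻¹                ∎
theorem3p2 ℝ r 0<r _ h@(suc k) (h≤ρ , ρ<h+1) = c , *-pos 0<ε (⁻¹-pos 0<C) , bound
  where
  open RealField ℝ
  open OrderedField ℝ
  open LowerBound ℝ
  open Routing ℝ
  open ≤-Reasoning

  ρ ε H C c : Carrier
  ρ = (fromℕ 2 * r) ⁻¹
  ε = (fromℕ h + 1#) - ρ
  H = fromℕ (suc h)
  -- Both `ε * x` and `ε * y` are at most `8 * H * L`, and `h ≤ H`, so `ε * h * (x + y)` is at most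
  -- `16 * H * H * L`.
  C = fromℕ 16 * (H * H)
  c = ε * C ⁻¹

  0<2r : 0# < fromℕ 2 * r
  0<2r = *-pos (fromℕ-pos 1) 0<r

  0<C : 0# < C
  0<C = *-pos (fromℕ-pos 15) (*-pos (fromℕ-pos h) (fromℕ-pos h))

  ε+ρ≈H : ε + ρ ≈ H
  ε+ρ≈H = trans (a-b+b≈a (fromℕ h + 1#) ρ) (+-comm (fromℕ h) 1#)

  0≤ε : 0# ≤ ε
  0≤ε = +-cancelʳ-≤ ρ (≤-trans (≤-reflexive (+-identityˡ ρ))
    (≤-trans (proj₁ ρ<h+1) (≤-reflexive (sym ε+ρ≈H))))

  0<ε : 0# < ε
  0<ε = 0≤ε , λ 0≈ε → proj₂ ρ<h+1 (trans (sym (+-identityˡ ρ)) (trans (+-congʳ 0≈ε) ε+ρ≈H))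

  ε≤1 : ε ≤ 1#
  ε≤1 = +-cancelʳ-≤ ρ (≤-trans (≤-reflexive ε+ρ≈H) (+-mono ≤-refl h≤ρ))

  bound : (N : ℕ) → 2 ℕ.≤ N →
    (design : ORNDesign N) → ORNDesign.GuaranteesThroughput design r →
    (Lmax : ℕ) → ORNDesign.IsMaxLatency design Lmax →
    (x y : Carrier) →
    IsRoot h (ε * fromℕ N) x → IsRoot (suc h) (fromℕ N) y →
    c * (fromℕ h * (x + y)) ≤ fromℕ Lmax
  bound N@(suc (suc _)) (s≤s (s≤s z≤n)) design guarantee L isMax x y (0≤x , x^h≈εN) (0≤y , y^H≈N) = begin
    ε * C ⁻¹ * (fromℕ h * (x + y))
      ≈⟨ solve 5 (λ e i t x y → e :* i :* (t :* (x :+ y)) := i :* (t :* (e :* x :+ e :* y)))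
           refl ε (C ⁻¹) (fromℕ h) x y ⟩
    C ⁻¹ * (fromℕ h * (ε * x + ε * y))
      ≤⟨ *-monoˡ (⁻¹-nonneg 0<C) (*-mono (+-nonneg (*-nonneg ε x 0≤ε 0≤x) (*-nonneg ε y 0≤ε 0≤y))
           (fromℕ-nonneg (suc h)) (fromℕ-mono (ℕ.n≤1+n h))
           (+-mono (≤-trans εx≤x x≤8HL) (≤-trans εy≤x x≤8HL))) ⟩
    C ⁻¹ * (H * (fromℕ 8 * H * fromℕ L + fromℕ 8 * H * fromℕ L))
      ≈⟨ *-congˡ (solve 3 (λ e H L → H :* (e :* H :* L :+ e :* H :* L) := (e :+ e) :* (H :* H) :* L)
           refl (fromℕ 8) H (fromℕ L)) ⟩
    C ⁻¹ * ((fromℕ 8 + fromℕ 8) * (H * H) * fromℕ L)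
      ≈⟨ *-congˡ (*-congʳ (*-congʳ (fromℕ-+ 8 8))) ⟨
    C ⁻¹ * (C * fromℕ L) ≈⟨ a⁻¹*[a*b]≈b (fromℕ L) 0<C ⟩
    fromℕ L ∎
    where
    n l : Carrier
    n = fromℕ N
    l = fromℕ (suc L)

    1≤4H : 1# ≤ fromℕ 4 * H
    1≤4H = ≤-trans (a≤a+b (fromℕ-nonneg 3)) (a≤a*b (fromℕ-nonneg 4) (a≤a+b (fromℕ-nonneg h)))

    0≤4H : 0# ≤ fromℕ 4 * H
    0≤4H = ≤-trans 0≤1 1≤4H

    x≤4Hl : x ≤ fromℕ 4 * H * l
    x≤4Hl = ^-cancel-≤ k 0≤x (*-nonneg _ l 0≤4H (fromℕ-nonneg (suc L))) (begin
      x ^ h                       ≈⟨ x^h≈εN ⟩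
      ε * n                       ≤⟨ εN≤4[h+1]ball 0<r h (⁻¹-inverseˡ 0<2r) (⁻¹-nonneg 0<2r) 0≤ε ε+ρ≈H
                                       design isMax guarantee ⟩
      -- As `4 * H` is at least `1`, raising it to the power `h` only increases it and makes the
      -- right side an `h`-th power.
      fromℕ 4 * H * l ^ h         ≤⟨ *-monoʳ (^-nonneg h (fromℕ-nonneg (suc L))) (a≤a^ k 1≤4H) ⟩
      (fromℕ 4 * H) ^ h * l ^ h   ≈⟨ *-^ (fromℕ 4 * H) l h ⟨
      (fromℕ 4 * H * l) ^ h       ∎)

    x≤8HL : x ≤ fromℕ 8 * H * fromℕ L
    x≤8HL = begin
      x                                   ≤⟨ x≤4Hl ⟩
      -- Here `L ≥ 1` gives `L + 1 ≤ 2 L`.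
      fromℕ 4 * H * l                     ≤⟨ *-monoˡ 0≤4H
      (+-mono (≤-trans (a≤a+b ≤-refl) (fromℕ-mono (1≤L design isMax))) ≤-refl) ⟩
      fromℕ 4 * H * (fromℕ L + fromℕ L)
        ≈⟨ solve 3 (λ f H L → f :* H :* (L :+ L) := (f :+ f) :* H :* L) refl (fromℕ 4) H (fromℕ L) ⟩
      (fromℕ 4 + fromℕ 4) * H * fromℕ L   ≈⟨ *-congʳ (*-congʳ (fromℕ-+ 4 4)) ⟨
      fromℕ 8 * H * fromℕ L               ∎

    εx≤x : ε * x ≤ x
    εx≤x = ≤-trans (*-monoʳ 0≤x ε≤1) (≤-reflexive (*-identityˡ x))

    ε^h≤ε : ε ^ h ≤ ε
    ε^h≤ε = begin
      ε * ε ^ k  ≤⟨ *-monoˡ 0≤ε (^-mono k 0≤ε ε≤1) ⟩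
      ε * 1# ^ k ≈⟨ *-congˡ (1^ k) ⟩
      ε * 1#     ≈⟨ *-identityʳ ε ⟩
      ε          ∎

    -- For `y ≥ 1` one more factor `y` gives `N`; otherwise the power is at most `1`.
    y^h≤n : y ^ h ≤ n
    y^h≤n with ≤-total 1# y
    ... | inj₁ 1≤y = begin
      y ^ h     ≤⟨ a≤b*a (^-nonneg h 0≤y) 1≤y ⟩
      y * y ^ h ≈⟨ y^H≈N ⟩
      n         ∎
    ... | inj₂ y≤1 = begin
      y ^ h  ≤⟨ ^-mono h 0≤y y≤1 ⟩
      1# ^ h ≈⟨ 1^ h ⟩
      1#     ≤⟨ a≤a+b (fromℕ-nonneg (ℕ.pred N)) ⟩
      n      ∎

    -- Comparing `h`-th powers, `ε ^ h ≤ ε` and `y ^ h ≤ N`. The factor `ε` in `c` thus absorbs the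
    -- second term of the latency bound into the first.
    εy≤x : ε * y ≤ x
    εy≤x = ^-cancel-≤ k (*-nonneg ε y 0≤ε 0≤y) 0≤x (begin
      (ε * y) ^ h   ≈⟨ *-^ ε y h ⟩
      ε ^ h * y ^ h ≤⟨ *-mono (^-nonneg h 0≤y) 0≤ε ε^h≤ε y^h≤n ⟩
      ε * n         ≈⟨ x^h≈εN ⟨
      x ^ h         ∎)
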